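{- Given any $\xi\in\mathbb{H}$ and any integer $N>1$, there exist $\mathbf{p},\mathbf{q}\in\mathcal{H}$ with $1\le|\mathbf{q}|_2\le N$ such that $$|\xi-\mathbf{p}\mathbf{q}^{ -1}|_2<\frac{2}{|\mathbf{q}|_2N}.$$ Moreover, there are infinitely many pairs $\mathbf{p},\mathbf{q}\in\mathcal{H}$ (with $\mathbf{q}\ne0$) such that $$|\xi-\mathbf{p}\mathbf{q}^{ -1}|_2<\frac{2}{|\mathbf{q}|_2^2}.$$
   Context: $\mathbb{H}$ denotes the real quaternions $\xi=a+bi+cj+dk$ with Euclidean norm $|\xi|_2=(a^2+b^2+c^2+d^2)^{1/2}$. The Hurwitz integers $\mathcal{H}$ are the quaternions $a+bi+cj+dk$ with either all of $a,b,c,d\in\mathbb{Z}$ or all of $a,b,c,d\in\mathbb{Z}+\frac12$. Pairs $\mathbf{p},\mathbf{q}$ are not required to be coprime. -}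

module Defs where

open import Data.Integer as ℤ using (ℤ; +_)
open import Data.Nat as ℕ using (ℕ; zero; suc)
import Data.Nat.Properties as ℕₚ
open import Data.Product using (∃-syntax; _×_; _,_; proj₁; proj₂)
open import Data.Rational as ℚ using (ℚ; 0ℚ; 1ℚ; ½)
open import Relation.Binary.PropositionalEquality using (_≡_; _≢_; refl; sym; trans; cong; cong₂; subst; subst₂; module ≡-Reasoning)

-- Cauchy sequences of rationals.  The existential is a Σ-type, so a proof of
-- Cauchy carries a modulus of convergence.

module Sequences where

  import Data.Integer.Properties as ℤₚ
  import Data.Integer.DivMod as ℤ
  import Data.Nat.Coprimality as Coprime
  open import Data.Rational hiding (nonNeg; pos)
  open import Data.Rational.Properties
  open import Data.Rational.Solver using (module +-*-Solver)
  open import Data.Sum using (inj₁; inj₂)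
  open import Relation.Nullary using (yes; no; contradiction)
  open import Relation.Nullary.Decidable using (toWitness)
  open +-*-Solver

  Cauchy : (ℕ → ℚ) → Set
  Cauchy x = ∀ ε → 0ℚ < ε → ∃[ M ] ∀ m n → M ℕ.≤ m → M ℕ.≤ n → ∣ x m - x n ∣ < ε

  private
    0<1 : 0ℚ < 1ℚ
    0<1 = toWitness {a? = 0ℚ <? 1ℚ} _

    +-pos : ∀ {p q} → 0ℚ < p → 0ℚ < q → 0ℚ < p + q
    +-pos = +-mono-<

    *-pos : ∀ {p q} → 0ℚ < p → 0ℚ < q → 0ℚ < p * q
    *-pos {p} {q} 0<p 0<q =
      positive⁻¹ (p * q) {{pos*pos⇒pos p {{positive 0<p}} q {{positive 0<q}}}}

    half-pos : ∀ {p} → 0ℚ < p → 0ℚ < p * ½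
    half-pos 0<p = *-pos 0<p (toWitness {a? = 0ℚ <? ½} _)

    half+half : ∀ p → p * ½ + p * ½ ≡ p
    half+half p = trans (sym (*-distribˡ-+ p ½ ½)) (*-identityʳ p)

    1/-pos : ∀ {p} (0<p : 0ℚ < p) → 0ℚ < (1/ p) {{>-nonZero 0<p}}
    1/-pos {p} 0<p = positive⁻¹ _ {{1/pos⇒pos p {{positive 0<p}}}}

    *-mono-≤ : ∀ {p q r s} → 0ℚ ≤ q → 0ℚ ≤ r → p ≤ q → r ≤ s → p * r ≤ q * s
    *-mono-≤ {p} {q} {r} {s} 0≤q 0≤r p≤q r≤s = ≤-trans
      (*-monoʳ-≤-nonNeg r {{nonNegative 0≤r}} p≤q)
      (*-monoˡ-≤-nonNeg q {{nonNegative 0≤q}} r≤s)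

    ≤∣∣ : ∀ p → p ≤ ∣ p ∣
    ≤∣∣ p with ≤-total 0ℚ p
    ... | inj₁ 0≤p = ≤-reflexive (sym (0≤p⇒∣p∣≡p 0≤p))
    ... | inj₂ p≤0 = ≤-trans p≤0 (0≤∣p∣ p)

    ∣∣< : ∀ {p q} → p < q → - p < q → ∣ p ∣ < q
    ∣∣< {p} {q} p<q -p<q with ∣p∣≡p∨∣p∣≡-p p
    ... | inj₁ eq = subst (_< q) (sym eq) p<q
    ... | inj₂ eq = subst (_< q) (sym eq) -p<q

    ∣-∣-comm : ∀ p q → ∣ p - q ∣ ≡ ∣ q - p ∣
    ∣-∣-comm p q = trans (sym (∣-p∣≡∣p∣ (p - q)))
      (cong ∣_∣ (solve 2 (λ p q → :- (p :- q) := q :- p) refl p q))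

    -- ∣p − q∣ < ε  gives  p < q + ε
    shift : ∀ {p q ε} → ∣ p - q ∣ < ε → p < q + ε
    shift {p} {q} h = subst (_< _) (solve 2 (λ p q → q :+ (p :- q) := p) refl p q)
      (+-monoʳ-< q (≤-<-trans (≤∣∣ (p - q)) h))

  cauchy-const : ∀ p → Cauchy (λ _ → p)
  cauchy-const p ε 0<ε = 0 , λ _ _ _ _ →
    subst (_< ε) (sym (cong ∣_∣ (+-inverseʳ p))) 0<ε

  cauchy-neg : ∀ {x} → Cauchy x → Cauchy (λ n → - x n)
  cauchy-neg {x} cx ε 0<ε = let M , h = cx ε 0<ε in M , λ m n M≤m M≤n →
    subst (_< ε) (trans (∣-∣-comm (x m) (x n)) (cong ∣_∣
      (solve 2 (λ p q → q :- p := :- p :- :- q) refl (x m) (x n)))) (h m n M≤m M≤n)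

  cauchy-+ : ∀ {x y} → Cauchy x → Cauchy y → Cauchy (λ n → x n + y n)
  cauchy-+ {x} {y} cx cy ε 0<ε = L ℕ.⊔ M , λ m n hm hn → begin-strict
    ∣ (x m + y m) - (x n + y n) ∣
      ≡⟨ cong ∣_∣ (solve 4 (λ a b c d → (a :+ b) :- (c :+ d) := (a :- c) :+ (b :- d))
           refl (x m) (y m) (x n) (y n)) ⟩
    ∣ (x m - x n) + (y m - y n) ∣    ≤⟨ ∣p+q∣≤∣p∣+∣q∣ (x m - x n) (y m - y n) ⟩
    ∣ x m - x n ∣ + ∣ y m - y n ∣
      <⟨ +-mono-< (f m n (ℕₚ.m⊔n≤o⇒m≤o L M hm) (ℕₚ.m⊔n≤o⇒m≤o L M hn))
                  (g m n (ℕₚ.m⊔n≤o⇒n≤o L M hm) (ℕₚ.m⊔n≤o⇒n≤o L M hn)) ⟩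
    ε * ½ + ε * ½                    ≡⟨ half+half ε ⟩
    ε ∎
    where
    open ≤-Reasoning
    L = proj₁ (cx (ε * ½) (half-pos 0<ε))
    f = proj₂ (cx (ε * ½) (half-pos 0<ε))
    M = proj₁ (cy (ε * ½) (half-pos 0<ε))
    g = proj₂ (cy (ε * ½) (half-pos 0<ε))

  cauchy-bounded : ∀ {x} → Cauchy x →
    ∃[ B ] 0ℚ < B × ∃[ M ] ∀ n → M ℕ.≤ n → ∣ x n ∣ ≤ B
  cauchy-bounded {x} cx = let M , h = cx 1ℚ 0<1 in
    ∣ x M ∣ + 1ℚ , +-mono-≤-< (0≤∣p∣ (x M)) 0<1 , M , λ n M≤n → begin
      ∣ x n ∣
        ≡⟨ cong ∣_∣ (solve 2 (λ p q → p := q :+ (p :- q)) refl (x n) (x M)) ⟩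
      ∣ x M + (x n - x M) ∣     ≤⟨ ∣p+q∣≤∣p∣+∣q∣ (x M) (x n - x M) ⟩
      ∣ x M ∣ + ∣ x n - x M ∣   ≤⟨ +-monoʳ-≤ ∣ x M ∣ (<⇒≤ (h n M M≤n ℕₚ.≤-refl)) ⟩
      ∣ x M ∣ + 1ℚ ∎
    where open ≤-Reasoning

  private
    product-split : ∀ a b c d → a * b - c * d ≡ a * (b - d) + d * (a - c)
    product-split = solve 4 (λ a b c d →
      a :* b :- c :* d := a :* (b :- d) :+ d :* (a :- c)) refl

    product-close : ∀ {a b c d p q δ} → 0ℚ < p → 0ℚ < q →
      ∣ a ∣ ≤ p → ∣ d ∣ ≤ q → ∣ a - c ∣ < δ → ∣ b - d ∣ < δ →
      ∣ a * b - c * d ∣ < (p + q) * δ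
    product-close {a} {b} {c} {d} {p} {q} {δ} 0<p 0<q a≤p d≤q ac bd = begin-strict
      ∣ a * b - c * d ∣                   ≡⟨ cong ∣_∣ (product-split a b c d) ⟩
      ∣ a * (b - d) + d * (a - c) ∣       ≤⟨ ∣p+q∣≤∣p∣+∣q∣ (a * (b - d)) (d * (a - c)) ⟩
      ∣ a * (b - d) ∣ + ∣ d * (a - c) ∣
        ≡⟨ cong₂ _+_ (∣p*q∣≡∣p∣*∣q∣ a (b - d)) (∣p*q∣≡∣p∣*∣q∣ d (a - c)) ⟩
      ∣ a ∣ * ∣ b - d ∣ + ∣ d ∣ * ∣ a - c ∣
        ≤⟨ +-mono-≤ (*-mono-≤ (<⇒≤ 0<p) (0≤∣p∣ (b - d)) a≤p ≤-refl)
                    (*-mono-≤ (<⇒≤ 0<q) (0≤∣p∣ (a - c)) d≤q ≤-refl) ⟩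
      p * ∣ b - d ∣ + q * ∣ a - c ∣
        <⟨ +-mono-< (*-monoʳ-<-pos p {{positive 0<p}} bd)
                    (*-monoʳ-<-pos q {{positive 0<q}} ac) ⟩
      p * δ + q * δ                       ≡⟨ sym (*-distribʳ-+ δ p q) ⟩
      (p + q) * δ                         ∎
      where open ≤-Reasoning

    divide : ∀ {p ε} → 0ℚ < p → 0ℚ < ε → ∃[ δ ] 0ℚ < δ × p * δ ≡ ε
    divide {p} {ε} 0<p 0<ε = 1/p * ε , *-pos (1/-pos 0<p) 0<ε ,
      trans (sym (*-assoc p 1/p ε))
        (trans (cong (_* ε) (*-inverseʳ p {{>-nonZero 0<p}})) (*-identityˡ ε))
      where 1/p = (1/ p) {{>-nonZero 0<p}}

  cauchy-* : ∀ {x y} → Cauchy x → Cauchy y → Cauchy (λ n → x n * y n)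
  cauchy-* {x} {y} cx cy ε 0<ε =
    let bx , 0<bx , K , hx = cauchy-bounded {x} cx
        by , 0<by , L , hy = cauchy-bounded {y} cy
        δ , 0<δ , bδ≡ε     = divide (+-pos 0<bx 0<by) 0<ε
        M , f              = cx δ 0<δ
        N , g              = cy δ 0<δ
    in (K ℕ.⊔ L) ℕ.⊔ (M ℕ.⊔ N) , λ m n hm hn →
      let KL≤m = ℕₚ.m⊔n≤o⇒m≤o (K ℕ.⊔ L) (M ℕ.⊔ N) hm
          KL≤n = ℕₚ.m⊔n≤o⇒m≤o (K ℕ.⊔ L) (M ℕ.⊔ N) hn
          MN≤m = ℕₚ.m⊔n≤o⇒n≤o (K ℕ.⊔ L) (M ℕ.⊔ N) hm
          MN≤n = ℕₚ.m⊔n≤o⇒n≤o (K ℕ.⊔ L) (M ℕ.⊔ N) hn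
      in subst (∣ x m * y m - x n * y n ∣ <_) bδ≡ε
           (product-close {x m} {y m} {x n} {y n} 0<bx 0<by
             (hx m (ℕₚ.m⊔n≤o⇒m≤o K L KL≤m)) (hy n (ℕₚ.m⊔n≤o⇒n≤o K L KL≤n))
             (f m n (ℕₚ.m⊔n≤o⇒m≤o M N MN≤m) (ℕₚ.m⊔n≤o⇒m≤o M N MN≤n))
             (g m n (ℕₚ.m⊔n≤o⇒n≤o M N MN≤m) (ℕₚ.m⊔n≤o⇒n≤o M N MN≤n)))

  -- Reciprocal of a rational, with value 0 at 0.
  recipℚ : ℚ → ℚ
  recipℚ p with p ≟ 0ℚ
  ... | yes _  = 0ℚ
  ... | no p≢0 = (1/ p) {{≢-nonZero p≢0}}

  recipℚ-inverse : ∀ p → p ≢ 0ℚ → p * recipℚ p ≡ 1ℚ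
  recipℚ-inverse p p≢0 with p ≟ 0ℚ
  ... | yes p≡0 = contradiction p≡0 p≢0
  ... | no p≢0′ = *-inverseʳ p {{≢-nonZero p≢0′}}

  private
    recip-diff : ∀ {p q} → p ≢ 0ℚ → q ≢ 0ℚ → (recipℚ p - recipℚ q) * (p * q) ≡ q - p
    recip-diff {p} {q} p≢0 q≢0 = begin
      (recipℚ p - recipℚ q) * (p * q)               ≡⟨ expand p q (recipℚ p) (recipℚ q) ⟩
      q * (p * recipℚ p) - p * (q * recipℚ q)
        ≡⟨ cong₂ (λ i j → q * i - p * j) (recipℚ-inverse p p≢0) (recipℚ-inverse q q≢0) ⟩
      q * 1ℚ - p * 1ℚ                               ≡⟨ cong₂ _-_ (*-identityʳ q) (*-identityʳ p) ⟩
      q - p                                         ∎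
      where
      open ≡-Reasoning
      expand : ∀ p q i j → (i - j) * (p * q) ≡ q * (p * i) - p * (q * j)
      expand = solve 4 (λ p q i j →
        (i :- j) :* (p :* q) := q :* (p :* i) :- p :* (q :* j)) refl

    recip-close : ∀ {p q δ ε} → 0ℚ < δ → δ ≤ p → δ ≤ q → ∣ q - p ∣ < (δ * δ) * ε →
      ∣ recipℚ p - recipℚ q ∣ < ε
    recip-close {p} {q} {δ} {ε} 0<δ δ≤p δ≤q h =
      *-cancelˡ-<-nonNeg (δ * δ) {{nonNegative (<⇒≤ (*-pos 0<δ 0<δ))}} (begin-strict
        (δ * δ) * ∣ recipℚ p - recipℚ q ∣
          ≤⟨ *-mono-≤ (<⇒≤ 0<pq) (0≤∣p∣ (recipℚ p - recipℚ q))
               (*-mono-≤ (<⇒≤ 0<p) (<⇒≤ 0<δ) δ≤p δ≤q) ≤-refl ⟩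
        (p * q) * ∣ recipℚ p - recipℚ q ∣
          ≡⟨ cong (_* ∣ recipℚ p - recipℚ q ∣) (sym (0≤p⇒∣p∣≡p (<⇒≤ 0<pq))) ⟩
        ∣ p * q ∣ * ∣ recipℚ p - recipℚ q ∣
          ≡⟨ *-comm ∣ p * q ∣ ∣ recipℚ p - recipℚ q ∣ ⟩
        ∣ recipℚ p - recipℚ q ∣ * ∣ p * q ∣
          ≡⟨ sym (∣p*q∣≡∣p∣*∣q∣ (recipℚ p - recipℚ q) (p * q)) ⟩
        ∣ (recipℚ p - recipℚ q) * (p * q) ∣
          ≡⟨ cong ∣_∣ (recip-diff (λ eq → <⇒≢ 0<p (sym eq)) (λ eq → <⇒≢ 0<q (sym eq))) ⟩
        ∣ q - p ∣     <⟨ h ⟩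
        (δ * δ) * ε   ∎)
      where
      open ≤-Reasoning
      0<p = <-≤-trans 0<δ δ≤p
      0<q = <-≤-trans 0<δ δ≤q
      0<pq = *-pos 0<p 0<q

  cauchy-recip : ∀ {x} → Cauchy x →
    (∃[ δ ] 0ℚ < δ × ∃[ M ] ∀ n → M ℕ.≤ n → δ ≤ x n) → Cauchy (λ n → recipℚ (x n))
  cauchy-recip {x} cx (δ , 0<δ , K , hδ) ε 0<ε =
    let L , h = cx ((δ * δ) * ε) (*-pos (*-pos 0<δ 0<δ) 0<ε)
    in K ℕ.⊔ L , λ m n hm hn → recip-close {x m} {x n} 0<δ
         (hδ m (ℕₚ.m⊔n≤o⇒m≤o K L hm)) (hδ n (ℕₚ.m⊔n≤o⇒m≤o K L hn))
         (h n m (ℕₚ.m⊔n≤o⇒n≤o K L hn) (ℕₚ.m⊔n≤o⇒n≤o K L hm))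

  isqrt : ℕ → ℕ
  isqrt zero = zero
  isqrt (suc n) with suc (isqrt n) ℕ.* suc (isqrt n) ℕ.≤? suc n
  ... | yes _ = suc (isqrt n)
  ... | no  _ = isqrt n

  isqrt-lower : ∀ n → isqrt n ℕ.* isqrt n ℕ.≤ n
  isqrt-lower zero = ℕ.z≤n
  isqrt-lower (suc n) with suc (isqrt n) ℕ.* suc (isqrt n) ℕ.≤? suc n
  ... | yes le = le
  ... | no  _  = ℕₚ.m≤n⇒m≤1+n (isqrt-lower n)

  isqrt-upper : ∀ n → n ℕ.< suc (isqrt n) ℕ.* suc (isqrt n)
  isqrt-upper zero = ℕ.s≤s ℕ.z≤n
  isqrt-upper (suc n) with suc (isqrt n) ℕ.* suc (isqrt n) ℕ.≤? suc n
  ... | no ¬le = ℕₚ.≰⇒> ¬le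
  ... | yes _  = ℕₚ.≤-<-trans (isqrt-upper n) (ℕₚ.*-mono-< k<1+k k<1+k)
    where k<1+k = ℕₚ.n<1+n (suc (isqrt n))

  ι : ℕ → ℚ
  ι n = mkℚ (+ n) 0 (Coprime.sym (Coprime.1-coprimeTo n))

  1/suc : ℕ → ℚ
  1/suc n = 1/ ι (suc n)

  -- The largest multiple r ≥ 0 of 1/(n+1) with r² ≤ max(x,0).
  rootℚ : ℚ → ℕ → ℚ
  rootℚ x n = ι (isqrt ℤ.∣ ⌊ (x ⊔ 0ℚ) * (ι (suc n) * ι (suc n)) ⌋ ∣) * 1/suc n

  private
    ι-/ : ∀ n → + n / 1 ≡ ι n
    ι-/ n = ↥p/↧p≡p (ι n)

    ι-mono-≤ : ∀ {m n} → m ℕ.≤ n → ι m ≤ ι n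
    ι-mono-≤ m≤n = *≤* (ℤₚ.*-monoʳ-≤-nonNeg (+ 1) (ℤ.+≤+ m≤n))

    ι-mono-< : ∀ {m n} → m ℕ.< n → ι m < ι n
    ι-mono-< m<n = *<* (ℤₚ.*-monoʳ-<-pos (+ 1) (ℤ.+<+ m<n))

    ι-* : ∀ m n → ι (m ℕ.* n) ≡ ι m * ι n
    ι-* m n = trans (sym (ι-/ (m ℕ.* n))) (cong (_/ 1) (ℤₚ.pos-* m n))

    ι-suc : ∀ n → ι (suc n) ≡ ι n + 1ℚ
    ι-suc n = trans (sym (ι-/ (suc n))) (cong (_/ 1) (begin
      + suc n                      ≡⟨ cong +_ (ℕₚ.+-comm 1 n) ⟩
      + n ℤ.+ + 1                  ≡⟨ cong (ℤ._+ + 1) (sym (ℤₚ.*-identityʳ (+ n))) ⟩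
      + n ℤ.* + 1 ℤ.+ + 1 ℤ.* + 1  ∎))
      where open ≡-Reasoning

    0<ι-suc : ∀ n → 0ℚ < ι (suc n)
    0<ι-suc n = positive⁻¹ (ι (suc n))

    0<1/suc : ∀ n → 0ℚ < 1/suc n
    0<1/suc n = positive⁻¹ (1/suc n)

    floor-spec : ∀ y → 0ℚ ≤ y → ι ℤ.∣ ⌊ y ⌋ ∣ ≤ y × y < ι (suc ℤ.∣ ⌊ y ⌋ ∣)
    floor-spec y@(mkℚ n d-1 _) 0≤y =
        *≤* (subst₂ ℤ._≤_ (cong (ℤ._* ↧ y) (sym ∣f∣)) (sym (ℤₚ.*-identityʳ n))
               (ℤ.[n/d]*d≤n n (↧ y)))
      , *<* (subst₂ ℤ._<_ (sym (ℤₚ.*-identityʳ n)) (cong (ℤ._* ↧ y) eq)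
               (ℤ.n<s[n/ℕd]*d n (suc d-1)))
      where
      0≤n : + 0 ℤ.≤ n
      0≤n = subst (+ 0 ℤ.≤_) (ℤₚ.*-identityʳ n) (drop-*≤* 0≤y)
      ∣f∣ : + ℤ.∣ ⌊ y ⌋ ∣ ≡ ⌊ y ⌋
      ∣f∣ = ℤₚ.0≤i⇒+∣i∣≡i (ℤ.0≤n⇒0≤n/d n (↧ y) 0≤n (ℤ.+≤+ ℕ.z≤n))
      eq : ℤ.suc (n ℤ./ℕ suc d-1) ≡ + suc ℤ.∣ ⌊ y ⌋ ∣
      eq = cong ℤ.suc (trans (sym (ℤ.div-pos-is-/ℕ n (suc d-1))) (sym ∣f∣))

  private
    unscale : ∀ a {N δ} → N * δ ≡ 1ℚ → (a * (N * N)) * (δ * δ) ≡ a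
    unscale a {N} {δ} Nδ≡1 = begin
      (a * (N * N)) * (δ * δ)      ≡⟨ regroup a N δ ⟩
      a * ((N * δ) * (N * δ))      ≡⟨ cong (λ t → a * (t * t)) Nδ≡1 ⟩
      a * 1ℚ                       ≡⟨ *-identityʳ a ⟩
      a                            ∎
      where
      open ≡-Reasoning
      regroup : ∀ a N δ → (a * (N * N)) * (δ * δ) ≡ a * ((N * δ) * (N * δ))
      regroup = solve 3 (λ a N δ →
        (a :* (N :* N)) :* (δ :* δ) := a :* ((N :* δ) :* (N :* δ))) refl

    square-* : ∀ s δ → (s * δ) * (s * δ) ≡ (s * s) * (δ * δ)
    square-* = solve 2 (λ s δ → (s :* δ) :* (s :* δ) := (s :* s) :* (δ :* δ)) refl

    suc-* : ∀ s δ → s * δ + δ ≡ (s + 1ℚ) * δ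
    suc-* s δ = trans (cong (λ t → s * δ + t) (sym (*-identityˡ δ))) (sym (*-distribʳ-+ δ s 1ℚ))

    root-bounds : ∀ a y δ m → 0ℚ < δ → y * (δ * δ) ≡ a → ι m ≤ y → y < ι (suc m) →
      let r = ι (isqrt m) * δ in 0ℚ ≤ r × r * r ≤ a × a < (r + δ) * (r + δ)
    root-bounds a y δ m 0<δ yδδ≡a m≤y y<1+m =
        nonNegative⁻¹ (ι s * δ) {{nonNeg*nonNeg⇒nonNeg (ι s) δ {{nonNegative (<⇒≤ 0<δ)}}}}
      , lower , upper
      where
      open ≤-Reasoning
      s = isqrt m
      0<δδ : 0ℚ < δ * δ
      0<δδ = *-pos 0<δ 0<δ
      lower : (ι s * δ) * (ι s * δ) ≤ a
      lower = begin
        (ι s * δ) * (ι s * δ)     ≡⟨ square-* (ι s) δ ⟩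
        (ι s * ι s) * (δ * δ)     ≡⟨ cong (_* (δ * δ)) (sym (ι-* s s)) ⟩
        ι (s ℕ.* s) * (δ * δ)
          ≤⟨ *-monoʳ-≤-nonNeg (δ * δ) {{nonNegative (<⇒≤ 0<δδ)}}
               (≤-trans (ι-mono-≤ (isqrt-lower m)) m≤y) ⟩
        y * (δ * δ)               ≡⟨ yδδ≡a ⟩
        a                         ∎
      upper : a < (ι s * δ + δ) * (ι s * δ + δ)
      upper = begin-strict
        a                                       ≡⟨ sym yδδ≡a ⟩
        y * (δ * δ)
          <⟨ *-monoˡ-<-pos (δ * δ) {{positive 0<δδ}}
               (<-≤-trans y<1+m (ι-mono-≤ (isqrt-upper m))) ⟩
        ι (suc s ℕ.* suc s) * (δ * δ)           ≡⟨ cong (_* (δ * δ)) (ι-* (suc s) (suc s)) ⟩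
        (ι (suc s) * ι (suc s)) * (δ * δ)       ≡⟨ sym (square-* (ι (suc s)) δ) ⟩
        (ι (suc s) * δ) * (ι (suc s) * δ)
          ≡⟨ cong (λ t → t * t) (trans (cong (_* δ) (ι-suc s)) (sym (suc-* (ι s) δ))) ⟩
        (ι s * δ + δ) * (ι s * δ + δ)           ∎

  rootℚ-spec : ∀ x n → let r = rootℚ x n; δ = 1/suc n in
    0ℚ ≤ r × r * r ≤ x ⊔ 0ℚ × x ⊔ 0ℚ < (r + δ) * (r + δ)
  rootℚ-spec x n =
    let m≤y , y<1+m = floor-spec y 0≤y
    in root-bounds a y (1/suc n) ℤ.∣ ⌊ y ⌋ ∣ (0<1/suc n)
         (unscale a {ι (suc n)} {1/suc n} (*-inverseʳ (ι (suc n)))) m≤y y<1+m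
    where
    a = x ⊔ 0ℚ
    NN = ι (suc n) * ι (suc n)
    y = a * NN
    0≤NN : 0ℚ ≤ NN
    0≤NN = <⇒≤ (*-pos (0<ι-suc n) (0<ι-suc n))
    0≤y : 0ℚ ≤ y
    0≤y = nonNegative⁻¹ y
      {{nonNeg*nonNeg⇒nonNeg a {{nonNegative (p≤q⊔p x 0ℚ)}} NN {{nonNegative 0≤NN}}}}

  private
    archimedean : ∀ ε → 0ℚ < ε → ∃[ M ] ∀ n → M ℕ.≤ n → 1/suc n ≤ ε
    archimedean ε@(mkℚ k d _) 0<ε = d , λ n d≤n →
      *≤* (begin
        + 1 ℤ.* + suc d   ≡⟨ ℤₚ.*-identityˡ (+ suc d) ⟩
        + suc d           ≤⟨ ℤ.+≤+ (ℕ.s≤s d≤n) ⟩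
        + suc n           ≡⟨ sym (ℤₚ.*-identityˡ (+ suc n)) ⟩
        + 1 ℤ.* + suc n   ≤⟨ ℤₚ.*-monoʳ-≤-nonNeg (+ suc n) (ℤₚ.i<j⇒suc[i]≤j 0<k) ⟩
        k ℤ.* + suc n     ∎)
      where
      open ℤₚ.≤-Reasoning
      0<k : + 0 ℤ.< k
      0<k = subst (+ 0 ℤ.<_) (ℤₚ.*-identityʳ k) (drop-*<* 0<ε)

    square-+ : ∀ s η → (s + η) * (s + η) + η * η + ((s + η) * η + (s + η) * η)
                     ≡ (s + (η + η)) * (s + (η + η))
    square-+ = solve 2 (λ s η →
      (s :+ η) :* (s :+ η) :+ η :* η :+ ((s :+ η) :* η :+ (s :+ η) :* η)
        := (s :+ (η :+ η)) :* (s :+ (η :+ η))) refl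

    -- η = ε/2;  √(b + η²) < √b + η
    root-close : ∀ {a b r s δ η} → 0ℚ < η → 0ℚ ≤ s → 0ℚ < δ → δ ≤ η →
      r * r ≤ a → a ≤ b + η * η → b < (s + δ) * (s + δ) → r < s + (η + η)
    root-close {a} {b} {r} {s} {δ} {η} 0<η 0≤s 0<δ δ≤η rr≤a a≤b+ηη b< = ≰⇒> λ le →
      <-irrefl refl (begin-strict
        r * r                                 ≤⟨ rr≤a ⟩
        a                                     ≤⟨ a≤b+ηη ⟩
        b + η * η                             <⟨ +-monoˡ-< (η * η) b< ⟩
        (s + δ) * (s + δ) + η * η
          ≤⟨ +-monoˡ-≤ (η * η) (*-mono-≤ 0≤s+η 0≤s+δ s+δ≤s+η s+δ≤s+η) ⟩
        (s + η) * (s + η) + η * η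
          ≡⟨ sym (+-identityʳ _) ⟩
        (s + η) * (s + η) + η * η + 0ℚ
          ≤⟨ +-monoʳ-≤ ((s + η) * (s + η) + η * η) 0≤cross ⟩
        (s + η) * (s + η) + η * η + ((s + η) * η + (s + η) * η)
          ≡⟨ square-+ s η ⟩
        (s + (η + η)) * (s + (η + η))
          ≤⟨ *-mono-≤ (≤-trans 0≤s+2η le) 0≤s+2η le le ⟩
        r * r                                 ∎)
      where
      open ≤-Reasoning
      0≤s+δ = +-mono-≤ 0≤s (<⇒≤ 0<δ)
      0≤s+η = +-mono-≤ 0≤s (<⇒≤ 0<η)
      0≤s+2η = +-mono-≤ 0≤s (<⇒≤ (+-pos 0<η 0<η))
      s+δ≤s+η = +-monoʳ-≤ s δ≤η
      0≤cross : 0ℚ ≤ (s + η) * η + (s + η) * η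
      0≤cross = +-mono-≤ h h
        where h = <⇒≤ (*-pos (+-mono-≤-< 0≤s 0<η) 0<η)

    ⊔0-shift : ∀ {p q η} → 0ℚ ≤ η → p ≤ q + η → p ⊔ 0ℚ ≤ (q ⊔ 0ℚ) + η
    ⊔0-shift {p} {q} {η} 0≤η h = ⊔-lub
      (≤-trans h (+-monoˡ-≤ η (p≤p⊔q q 0ℚ)))
      (+-mono-≤ (p≤q⊔p q 0ℚ) 0≤η)

    ∣∣<-intro : ∀ {p q ε} → p < q + ε → q < p + ε → ∣ p - q ∣ < ε
    ∣∣<-intro {p} {q} {ε} p< q< = ∣∣< (diff p q ε p<) (subst (_< ε) (swap p q) (diff q p ε q<))
      where
      cancel : ∀ q e → q + e - q ≡ e
      cancel = solve 2 (λ q e → q :+ e :- q := e) refl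
      swap : ∀ p q → q - p ≡ - (p - q)
      swap = solve 2 (λ p q → q :- p := :- (p :- q)) refl
      diff : ∀ p q e → p < q + e → p - q < e
      diff p q e lt = subst (p - q <_) (cancel q e) (+-monoˡ-< (- q) lt)

  cauchy-root : ∀ {x} → Cauchy x → Cauchy (λ n → rootℚ (x n) n)
  cauchy-root {x} cx ε 0<ε = K ℕ.⊔ L , λ m n hm hn →
    ∣∣<-intro {rootℚ (x m) m} {rootℚ (x n) n} (close m n hm hn) (close n m hn hm)
    where
    η = ε * ½
    0<η = half-pos 0<ε
    0<ηη = *-pos 0<η 0<η
    K = proj₁ (cx (η * η) 0<ηη)
    h = proj₂ (cx (η * η) 0<ηη)
    L = proj₁ (archimedean η 0<η)
    g = proj₂ (archimedean η 0<η)
    close : ∀ m n → K ℕ.⊔ L ℕ.≤ m → K ℕ.⊔ L ℕ.≤ n → rootℚ (x m) m < rootℚ (x n) n + ε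
    close m n hm hn =
      let _   , r≤ , _  = rootℚ-spec (x m) m
          0≤s , _  , <s = rootℚ-spec (x n) n
      in subst (λ e → rootℚ (x m) m < rootℚ (x n) n + e) (half+half ε)
           (root-close {x m ⊔ 0ℚ} {x n ⊔ 0ℚ} {rootℚ (x m) m} {rootℚ (x n) n} {1/suc n} {η}
             0<η 0≤s (0<1/suc n) (g n (ℕₚ.m⊔n≤o⇒n≤o K L hn)) r≤
             (⊔0-shift {x m} {x n} (<⇒≤ 0<ηη)
               (<⇒≤ (shift {x m} {x n}
                 (h m n (ℕₚ.m⊔n≤o⇒m≤o K L hm) (ℕₚ.m⊔n≤o⇒m≤o K L hn))))) <s)

-- Real numbers.  Two sequences denote the same real when their difference
-- tends to 0; this equality is written x ≤ y × y ≤ x and never needed below.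

record ℝ : Set where
  constructor mkℝ
  field
    seq    : ℕ → ℚ
    cauchy : Sequences.Cauchy seq

open ℝ public

infix  4 _<_ _≤_
infixl 6 _+_ _-_
infixl 7 _*_
infix  8 -_

record _<_ (x y : ℝ) : Set where
  constructor *<*
  field
    drop-*<* : ∃[ ε ] 0ℚ ℚ.< ε × ∃[ M ] ∀ n → M ℕ.≤ n → seq x n ℚ.+ ε ℚ.≤ seq y n

record _≤_ (x y : ℝ) : Set where
  constructor *≤*
  field
    drop-*≤* : ∀ ε → 0ℚ ℚ.< ε → ∃[ M ] ∀ n → M ℕ.≤ n → seq x n ℚ.≤ seq y n ℚ.+ ε

fromℚ : ℚ → ℝ
fromℚ p = mkℝ (λ _ → p) (Sequences.cauchy-const p)

fromℤ : ℤ → ℝ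
fromℤ i = fromℚ (i ℚ./ 1)

0ℝ 1ℝ 2ℝ : ℝ
0ℝ = fromℤ (+ 0)
1ℝ = fromℤ (+ 1)
2ℝ = fromℤ (+ 2)

-- Opaque, since unfolding these to sequences makes type checking of compound
-- real expressions prohibitively slow.
opaque
  -_ : ℝ → ℝ
  - x = mkℝ (λ n → ℚ.- seq x n) (Sequences.cauchy-neg {seq x} (cauchy x))

  _+_ _*_ : ℝ → ℝ → ℝ
  x + y = mkℝ (λ n → seq x n ℚ.+ seq y n)
              (Sequences.cauchy-+ {seq x} {seq y} (cauchy x) (cauchy y))
  x * y = mkℝ (λ n → seq x n ℚ.* seq y n)
              (Sequences.cauchy-* {seq x} {seq y} (cauchy x) (cauchy y))

  -- The square root of max(x,0).
  √ : ℝ → ℝ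
  √ x = mkℝ (λ n → Sequences.rootℚ (seq x n) n) (Sequences.cauchy-root {seq x} (cauchy x))

  seq-neg : ∀ x n → seq (- x) n ≡ ℚ.- seq x n
  seq-neg _ _ = refl

  seq-+ : ∀ x y n → seq (x + y) n ≡ seq x n ℚ.+ seq y n
  seq-+ _ _ _ = refl

  seq-* : ∀ x y n → seq (x * y) n ≡ seq x n ℚ.* seq y n
  seq-* _ _ _ = refl

  seq-√ : ∀ x n → seq (√ x) n ≡ Sequences.rootℚ (seq x n) n
  seq-√ _ _ = refl

_-_ : ℝ → ℝ → ℝ
x - y = x + (- y)

module _ where
  open import Data.Rational.Properties

  private
    eventually-pos : ∀ {x} → 0ℝ < x →
      ∃[ δ ] 0ℚ ℚ.< δ × ∃[ M ] ∀ n → M ℕ.≤ n → δ ℚ.≤ seq x n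
    eventually-pos (*<* (δ , 0<δ , M , h)) =
      δ , 0<δ , M , λ n M≤n → subst (ℚ._≤ _) (+-identityˡ δ) (h n M≤n)

    mk-pos : ∀ x δ → 0ℚ ℚ.< δ → ∀ M → (∀ n → M ℕ.≤ n → δ ℚ.≤ seq x n) → 0ℝ < x
    mk-pos x δ 0<δ M h = *<*
      (δ , 0<δ , M , λ n M≤n → subst (ℚ._≤ seq x n) (sym (+-identityˡ δ)) (h n M≤n))

  opaque
    recip : (x : ℝ) → 0ℝ < x → ℝ
    recip x 0<x = mkℝ (λ n → Sequences.recipℚ (seq x n))
                      (Sequences.cauchy-recip {seq x} (cauchy x) (eventually-pos 0<x))

    seq-recip : ∀ x 0<x n → seq (recip x 0<x) n ≡ Sequences.recipℚ (seq x n)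
    seq-recip _ _ _ = refl

  opaque
    unfolding _*_

    *-pos : ∀ {x y} → 0ℝ < x → 0ℝ < y → 0ℝ < x * y
    *-pos {x} {y} 0<x 0<y =
      let δ , 0<δ , K , f = eventually-pos 0<x
          η , 0<η , L , g = eventually-pos 0<y
      in mk-pos (x * y) (δ ℚ.* η)
           (positive⁻¹ (δ ℚ.* η) {{pos*pos⇒pos δ {{ℚ.positive 0<δ}} η {{ℚ.positive 0<η}}}})
           (K ℕ.⊔ L) λ n hn →
             let δ≤ = f n (ℕₚ.m⊔n≤o⇒m≤o K L hn)
                 η≤ = g n (ℕₚ.m⊔n≤o⇒n≤o K L hn)
             in ≤-trans
                  (*-monoʳ-≤-nonNeg η {{ℚ.nonNegative (<⇒≤ 0<η)}} δ≤)
                  (*-monoˡ-≤-nonNeg (seq x n)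
                    {{ℚ.nonNegative (≤-trans (<⇒≤ 0<δ) δ≤)}} η≤)

  1≤⇒pos : ∀ {x} → 1ℝ ≤ x → 0ℝ < x
  1≤⇒pos {x} (*≤* 1≤x) =
    let M , h = 1≤x ½ (positive⁻¹ ½)
    in mk-pos x ½ (positive⁻¹ ½) M λ n M≤n → 1≤p+½⇒½≤p (h n M≤n)
    where
    1≤p+½⇒½≤p : ∀ {p} → 1ℚ ℚ.≤ p ℚ.+ ½ → ½ ℚ.≤ p
    1≤p+½⇒½≤p {p} h = subst (½ ℚ.≤_)
      (trans (+-assoc p ½ (ℚ.- ½)) (+-identityʳ p)) (+-monoˡ-≤ (ℚ.- ½) h)

  fromℤ-pos : ∀ {i} → + 1 ℤ.< i → 0ℝ < fromℤ i
  fromℤ-pos {+ suc n} _ = mk-pos (fromℤ (+ suc n)) (+ suc n ℚ./ 1)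
    (positive⁻¹ (+ suc n ℚ./ 1) {{normalize-pos (suc n) 1}}) 0 λ _ _ → ≤-refl
  fromℤ-pos {+ zero} (ℤ.+<+ ())

infixl 7 _/_[_]

_/_[_] : ℝ → (y : ℝ) → 0ℝ < y → ℝ
x / y [ 0<y ] = x * recip y 0<y

record ℍ : Set where
  constructor ⟨_,_,_,_⟩
  field
    re im-i im-j im-k : ℝ

infixl 6 _-ₕ_
infixl 7 _*ₕ_

_-ₕ_ : ℍ → ℍ → ℍ
⟨ a , b , c , d ⟩ -ₕ ⟨ a′ , b′ , c′ , d′ ⟩ = ⟨ a - a′ , b - b′ , c - c′ , d - d′ ⟩

_*ₕ_ : ℍ → ℍ → ℍ
⟨ a , b , c , d ⟩ *ₕ ⟨ a′ , b′ , c′ , d′ ⟩ =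
  ⟨ a * a′ - b * b′ - c * c′ - d * d′
  , a * b′ + b * a′ + c * d′ - d * c′
  , a * c′ - b * d′ + c * a′ + d * b′
  , a * d′ + b * c′ - c * b′ + d * a′ ⟩

∣_∣₂ : ℍ → ℝ
∣ ⟨ a , b , c , d ⟩ ∣₂ = √ (a * a + b * b + c * c + d * d)

-- ξ⁻¹ = conj(ξ) / |ξ|².  As ξ ≠ 0 must be witnessed, it is given as 0 < |ξ|.
inv : (ξ : ℍ) → 0ℝ < ∣ ξ ∣₂ → ℍ
inv ξ@(⟨ a , b , c , d ⟩) ξ≠0 = ⟨ a * t , - b * t , - c * t , - d * t ⟩
  where t = recip (∣ ξ ∣₂ * ∣ ξ ∣₂) (*-pos ξ≠0 ξ≠0)

-- half a b c d is (a + ½) + (b + ½)i + (c + ½)j + (d + ½)k.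
data Hurwitz : Set where
  whole half : (a b c d : ℤ) → Hurwitz

toℍ : Hurwitz → ℍ
toℍ (whole a b c d) = ⟨ fromℤ a , fromℤ b , fromℤ c , fromℤ d ⟩
toℍ (half a b c d)  = ⟨ h a , h b , h c , h d ⟩
  where
  h : ℤ → ℝ
  h i = fromℤ i + fromℚ ½

{-# OPTIONS --safe #-}

-- For rational ξ = X/d, the vectors (q, ξq − p) form a rank two right module
-- over the Hurwitz order.  As every quaternion lies within 1/√2 of a Hurwitz
-- integer, Gauss reduction of the Hermitian form 2|q|² + N⁴|ξq − p|² ends with a
-- nonzero vector of value at most 2N²; hence |q| ≤ N and |ξq − p| ≤ √2/N.  The gap
-- between √2 and 2 absorbs the passage from rational to real ξ and the replacement
-- of |q| by its rational approximations.
module Submission where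

open import Data.Integer as ℤ using (ℤ; +_; -[1+_])
import Data.Integer.DivMod as ℤDivMod
import Data.Integer.Properties as ℤₚ
open import Data.Integer.Solver using () renaming (module +-*-Solver to ℤSolver)
open import Data.Nat as ℕ using (ℕ; zero; suc)
import Data.Nat.Coprimality as Coprime
import Data.Nat.Properties as ℕₚ
open import Data.Product using (∃-syntax; Σ-syntax; _×_; _,_; proj₁; proj₂)
open import Data.Rational as ℚ using (ℚ; mkℚ; 0ℚ; 1ℚ; ½)
import Data.Rational.Properties as ℚₚ
open import Data.Rational.Solver using () renaming (module +-*-Solver to ℚSolver)
import Data.Rational.Unnormalised as ℚᵘ
import Data.Rational.Unnormalised.Properties as ℚᵘₚ
open import Data.Sum using (_⊎_; inj₁; inj₂)
open import Function.Definitions using (Injective)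
open import Relation.Binary.Definitions using (tri<; tri≈; tri>)
open import Relation.Binary.PropositionalEquality using (_≡_; refl; sym; trans; cong; cong₂; subst; subst₂; module ≡-Reasoning)
open import Relation.Nullary using (yes; no; contradiction)
open import Relation.Nullary.Decidable using (toWitness)

-- Order on the reals is undecidable, so neither a pigeonhole count nor a search can run on ξ
-- itself. The search is an integer reduction for a rational approximation of ξ, and strict
-- inequalities of reals come from explicit rational estimates on late terms. The bound 2N² comes
-- from the determinant 2N⁴ of the form: rounding with squared error at most 1/2 stops at a value
-- whose square is at most 2 · 2N⁴. The quantity N²|ξq - p|², to be kept below 4, is thus at most 2
-- for the approximation. Passing to ξ raises it to 5/2, inverting q only approximately raises it to
-- 3, and 3 < (15/8)² leaves 1/8 of the target 2 for the gap that `_<_` demands.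
--
-- The split is made on the integer |q|²: a q that is short compared with N has an error so small
-- that an integer multiple of the pair is still good.

-- Quaternion arithmetic over arbitrary operations

record Quat (A : Set) : Set where
  constructor ⟪_,_,_,_⟫
  field
    c₀ c₁ c₂ c₃ : A

open Quat

ext : ∀ {A} {x y : Quat A} → c₀ x ≡ c₀ y → c₁ x ≡ c₁ y → c₂ x ≡ c₂ y → c₃ x ≡ c₃ y → x ≡ y
ext refl refl refl refl = refl

mapQ : ∀ {A B} → (A → B) → Quat A → Quat B
mapQ f ⟪ a , b , c , d ⟫ = ⟪ f a , f b , f c , f d ⟫

-- Instantiated both at numbers and at solver polynomials, so a quaternion law becomes four
-- polynomial identities. The bracketing is that of `_*ₕ_` and `∣_∣₂`, which makes the passage from
-- real to rational quaternions definitional.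
module QuatOps {A : Set} (_+_ _*_ : A → A → A) (-_ : A → A) where

  infixl 6 _⊕_ _⊖_
  infixl 7 _⊙_ _•_

  _⊕_ _⊖_ _⊙_ : Quat A → Quat A → Quat A
  ⟪ a , b , c , d ⟫ ⊕ ⟪ a′ , b′ , c′ , d′ ⟫ = ⟪ a + a′ , b + b′ , c + c′ , d + d′ ⟫
  ⟪ a , b , c , d ⟫ ⊖ ⟪ a′ , b′ , c′ , d′ ⟫ = ⟪ a + (- a′) , b + (- b′) , c + (- c′) , d + (- d′) ⟫
  ⟪ a , b , c , d ⟫ ⊙ ⟪ a′ , b′ , c′ , d′ ⟫ =
    ⟪ (((a * a′) + (- (b * b′))) + (- (c * c′))) + (- (d * d′))
    , (((a * b′) + (b * a′)) + (c * d′)) + (- (d * c′))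
    , (((a * c′) + (- (b * d′))) + (c * a′)) + (d * b′)
    , (((a * d′) + (b * c′)) + (- (c * b′))) + (d * a′) ⟫

  _•_ : A → Quat A → Quat A
  k • ⟪ a , b , c , d ⟫ = ⟪ k * a , k * b , k * c , k * d ⟫

  conj : Quat A → Quat A
  conj ⟪ a , b , c , d ⟫ = ⟪ a , - b , - c , - d ⟫

  dot : Quat A → Quat A → A
  dot ⟪ a , b , c , d ⟫ ⟪ a′ , b′ , c′ , d′ ⟫ = (((a * a′) + (b * b′)) + (c * c′)) + (d * d′)

  norm : Quat A → A
  norm x = dot x x

-- Integer quaternions and binary Hermitian forms

module IntegerForms where
  open import Data.Integer.Base using (_+_; _*_; -_; _-_; _≤_; _<_; 0ℤ)
  open ℤSolver
  open QuatOps _+_ _*_ -_ public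
  private
    module P {n} = QuatOps {Polynomial n} _:+_ _:*_ :-_

  *-nonNeg : ∀ {i j} → 0ℤ ≤ i → 0ℤ ≤ j → 0ℤ ≤ i * j
  *-nonNeg {i} {j} 0≤i 0≤j =
    subst (_≤ i * j) (ℤₚ.*-zeroʳ i) (ℤₚ.*-monoˡ-≤-nonNeg i {{ℤ.nonNegative 0≤i}} 0≤j)

  *-pos : ∀ {i j} → 0ℤ < i → 0ℤ < j → 0ℤ < i * j
  *-pos {i} {j} 0<i 0<j =
    subst (_< i * j) (ℤₚ.*-zeroʳ i) (ℤₚ.*-monoˡ-<-pos i {{ℤ.positive 0<i}} 0<j)

  square-nonNeg : ∀ i → 0ℤ ≤ i * i
  square-nonNeg (+ n)      = *-nonNeg {+ n} {+ n} (ℤ.+≤+ ℕ.z≤n) (ℤ.+≤+ ℕ.z≤n)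
  square-nonNeg (-[1+ n ]) = ℤ.+≤+ ℕ.z≤n

  norm-nonNeg : ∀ x → 0ℤ ≤ norm x
  norm-nonNeg ⟪ a , b , c , d ⟫ =
    ℤₚ.+-mono-≤ (ℤₚ.+-mono-≤ (ℤₚ.+-mono-≤ (square-nonNeg a) (square-nonNeg b))
      (square-nonNeg c)) (square-nonNeg d)

  ⊙-assoc : ∀ x y z → (x ⊙ y) ⊙ z ≡ x ⊙ (y ⊙ z)
  ⊙-assoc ⟪ a , b , c , d ⟫ ⟪ a′ , b′ , c′ , d′ ⟫ ⟪ a″ , b″ , c″ , d″ ⟫ = ext
    (solve 12 (law c₀) refl a b c d a′ b′ c′ d′ a″ b″ c″ d″)
    (solve 12 (law c₁) refl a b c d a′ b′ c′ d′ a″ b″ c″ d″)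
    (solve 12 (law c₂) refl a b c d a′ b′ c′ d′ a″ b″ c″ d″)
    (solve 12 (law c₃) refl a b c d a′ b′ c′ d′ a″ b″ c″ d″)
    where
    -- The projection `π` is polymorphic in the carrier: one statement of the law serves all four
    -- components.
    law : ∀ {n} → (∀ {A} → Quat A → A) → (_ _ _ _ _ _ _ _ _ _ _ _ : Polynomial n) → _
    law π a b c d a′ b′ c′ d′ a″ b″ c″ d″ =
      let x = ⟪ a , b , c , d ⟫; y = ⟪ a′ , b′ , c′ , d′ ⟫; z = ⟪ a″ , b″ , c″ , d″ ⟫ in
      π ((x P.⊙ y) P.⊙ z) := π (x P.⊙ (y P.⊙ z))

  conj-⊙-⊙ : ∀ x y → conj x ⊙ (x ⊙ y) ≡ norm x • y
  conj-⊙-⊙ ⟪ a , b , c , d ⟫ ⟪ a′ , b′ , c′ , d′ ⟫ = ext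
    (solve 8 (law c₀) refl a b c d a′ b′ c′ d′)
    (solve 8 (law c₁) refl a b c d a′ b′ c′ d′)
    (solve 8 (law c₂) refl a b c d a′ b′ c′ d′)
    (solve 8 (law c₃) refl a b c d a′ b′ c′ d′)
    where
    law : ∀ {n} → (∀ {A} → Quat A → A) → (_ _ _ _ _ _ _ _ : Polynomial n) → _
    law π a b c d a′ b′ c′ d′ =
      let x = ⟪ a , b , c , d ⟫; y = ⟪ a′ , b′ , c′ , d′ ⟫ in
      π (P.conj x P.⊙ (x P.⊙ y)) := π (P.norm x P.• y)

  norm-⊙ : ∀ x y → norm (x ⊙ y) ≡ norm x * norm y
  norm-⊙ ⟪ a , b , c , d ⟫ ⟪ a′ , b′ , c′ , d′ ⟫ = solve 8 (λ a b c d a′ b′ c′ d′ →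
    let x = ⟪ a , b , c , d ⟫; y = ⟪ a′ , b′ , c′ , d′ ⟫ in
    P.norm (x P.⊙ y) := P.norm x :* P.norm y) refl a b c d a′ b′ c′ d′

  norm-• : ∀ k x → norm (k • x) ≡ k * k * norm x
  norm-• k ⟪ a , b , c , d ⟫ = solve 5 (λ k a b c d →
    let x = ⟪ a , b , c , d ⟫ in
    P.norm (k P.• x) := k :* k :* P.norm x) refl k a b c d

  norm-2•-⊕ : ∀ x y → norm (+ 2 • x ⊕ y) ≡ + 4 * norm x + + 4 * dot x y + norm y
  norm-2•-⊕ ⟪ a , b , c , d ⟫ ⟪ a′ , b′ , c′ , d′ ⟫ = solve 8 (λ a b c d a′ b′ c′ d′ →
    let x = ⟪ a , b , c , d ⟫; y = ⟪ a′ , b′ , c′ , d′ ⟫ in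
    P.norm (con (+ 2) P.• x P.⊕ y) := con (+ 4) :* P.norm x :+ con (+ 4) :* P.dot x y :+ P.norm y) refl a b c d a′ b′ c′ d′

  -- Left multiplication by `conj x` is adjoint to left multiplication by `x`. In `F-shear` this
  -- gathers the cross terms of both coordinates into `dot (B u v) h`.
  dot-⊙ : ∀ x y z → dot y (x ⊙ z) ≡ dot (conj x ⊙ y) z
  dot-⊙ ⟪ a , b , c , d ⟫ ⟪ a′ , b′ , c′ , d′ ⟫ ⟪ a″ , b″ , c″ , d″ ⟫ =
    solve 12 (λ a b c d a′ b′ c′ d′ a″ b″ c″ d″ →
      let x = ⟪ a , b , c , d ⟫; y = ⟪ a′ , b′ , c′ , d′ ⟫; z = ⟪ a″ , b″ , c″ , d″ ⟫ in
      P.dot y (x P.⊙ z) := P.dot (P.conj x P.⊙ y) z)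
      refl a b c d a′ b′ c′ d′ a″ b″ c″ d″

  dot-• : ∀ k x y → dot x (k • y) ≡ k * dot x y
  dot-• k ⟪ a , b , c , d ⟫ ⟪ a′ , b′ , c′ , d′ ⟫ = solve 9 (λ k a b c d a′ b′ c′ d′ →
    let x = ⟪ a , b , c , d ⟫; y = ⟪ a′ , b′ , c′ , d′ ⟫ in
    P.dot x (k P.• y) := k :* P.dot x y) refl k a b c d a′ b′ c′ d′

  dot-linear : ∀ s x t y z → dot (s • x ⊕ t • y) z ≡ s * dot x z + t * dot y z
  dot-linear s ⟪ a , b , c , d ⟫ t ⟪ a′ , b′ , c′ , d′ ⟫ ⟪ a″ , b″ , c″ , d″ ⟫ =
    solve 14 (λ s a b c d t a′ b′ c′ d′ a″ b″ c″ d″ →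
      let x = ⟪ a , b , c , d ⟫; y = ⟪ a′ , b′ , c′ , d′ ⟫; z = ⟪ a″ , b″ , c″ , d″ ⟫ in
      P.dot (s P.• x P.⊕ t P.• y) z := s :* P.dot x z :+ t :* P.dot y z)
      refl s a b c d t a′ b′ c′ d′ a″ b″ c″ d″

  ⊙-• : ∀ x k y → x ⊙ (k • y) ≡ k • (x ⊙ y)
  ⊙-• ⟪ a , b , c , d ⟫ k ⟪ a′ , b′ , c′ , d′ ⟫ = ext
    (solve 9 (law c₀) refl k a b c d a′ b′ c′ d′)
    (solve 9 (law c₁) refl k a b c d a′ b′ c′ d′)
    (solve 9 (law c₂) refl k a b c d a′ b′ c′ d′)
    (solve 9 (law c₃) refl k a b c d a′ b′ c′ d′)
    where
    law : ∀ {n} → (∀ {A} → Quat A → A) → (_ _ _ _ _ _ _ _ _ : Polynomial n) → _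
    law π k a b c d a′ b′ c′ d′ =
      let x = ⟪ a , b , c , d ⟫; y = ⟪ a′ , b′ , c′ , d′ ⟫ in
      π (x P.⊙ (k P.• y)) := π (k P.• (x P.⊙ y))

  ⊙-linear : ∀ x k y z → x ⊙ (k • y ⊕ z) ≡ k • (x ⊙ y) ⊕ x ⊙ z
  ⊙-linear ⟪ a , b , c , d ⟫ k ⟪ a′ , b′ , c′ , d′ ⟫ ⟪ a″ , b″ , c″ , d″ ⟫ = ext
    (solve 13 (law c₀) refl k a b c d a′ b′ c′ d′ a″ b″ c″ d″)
    (solve 13 (law c₁) refl k a b c d a′ b′ c′ d′ a″ b″ c″ d″)
    (solve 13 (law c₂) refl k a b c d a′ b′ c′ d′ a″ b″ c″ d″)
    (solve 13 (law c₃) refl k a b c d a′ b′ c′ d′ a″ b″ c″ d″)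
    where
    law : ∀ {n} → (∀ {A} → Quat A → A) → (_ _ _ _ _ _ _ _ _ _ _ _ _ : Polynomial n) → _
    law π k a b c d a′ b′ c′ d′ a″ b″ c″ d″ =
      let x = ⟪ a , b , c , d ⟫; y = ⟪ a′ , b′ , c′ , d′ ⟫; z = ⟪ a″ , b″ , c″ , d″ ⟫ in
      π (x P.⊙ (k P.• y P.⊕ z)) := π (k P.• (x P.⊙ y) P.⊕ x P.⊙ z)

  norm-conj : ∀ x → norm (conj x) ≡ norm x
  norm-conj ⟪ a , b , c , d ⟫ = solve 4 (λ a b c d →
    let x = ⟪ a , b , c , d ⟫ in P.norm (P.conj x) := P.norm x) refl a b c d

  module Form (s t : ℤ) where

    F : Quat ℤ × Quat ℤ → ℤ
    F (x , y) = s * norm x + t * norm y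

    -- The pairing that polarises `F`. Conjugating the left argument makes it right linear in the
    -- second, and shears multiply from the right.
    B : Quat ℤ × Quat ℤ → Quat ℤ × Quat ℤ → Quat ℤ
    B (x , y) (x′ , y′) = s • (conj x ⊙ x′) ⊕ t • (conj y ⊙ y′)

    -- `B` is Hermitian, so `B u v` and `B v u` are conjugate. The two vectors can thus swap roles
    -- in the reduction.
    B-comm : ∀ u v → norm (B u v) ≡ norm (B v u)
    B-comm (x , y) (x′ , y′) =
      trans (cong norm (ext′ x y x′ y′)) (norm-conj (B (x′ , y′) (x , y)))
      where
      law : ∀ {n} → (∀ {A} → Quat A → A) → (_ _ _ _ _ _ _ _ _ _ _ _ _ _ _ _ _ _ : Polynomial n) → _
      law π s t a b c d a′ b′ c′ d′ e f g h e′ f′ g′ h′ =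
        let x = ⟪ a , b , c , d ⟫; y = ⟪ a′ , b′ , c′ , d′ ⟫; x′ = ⟪ e , f , g , h ⟫; y′ = ⟪ e′ , f′ , g′ , h′ ⟫ in
        π (s P.• (P.conj x P.⊙ x′) P.⊕ t P.• (P.conj y P.⊙ y′))
          := π (P.conj (s P.• (P.conj x′ P.⊙ x) P.⊕ t P.• (P.conj y′ P.⊙ y)))
      ext′ : ∀ x y x′ y′ → B (x , y) (x′ , y′) ≡ conj (B (x′ , y′) (x , y))
      ext′ ⟪ a , b , c , d ⟫ ⟪ a′ , b′ , c′ , d′ ⟫ ⟪ e , f , g , h ⟫ ⟪ e′ , f′ , g′ , h′ ⟫ = ext
        (solve 18 (law c₀) refl s t a b c d a′ b′ c′ d′ e f g h e′ f′ g′ h′)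
        (solve 18 (law c₁) refl s t a b c d a′ b′ c′ d′ e f g h e′ f′ g′ h′)
        (solve 18 (law c₂) refl s t a b c d a′ b′ c′ d′ e f g h e′ f′ g′ h′)
        (solve 18 (law c₃) refl s t a b c d a′ b′ c′ d′ e f g h e′ f′ g′ h′)

    -- v′ = v + u·(h/2), doubled to stay integral
    Shear : (u v v′ : Quat ℤ × Quat ℤ) → Quat ℤ → Set
    Shear (x , y) (x′ , y′) (x″ , y″) h =
      + 2 • x″ ≡ + 2 • x′ ⊕ x ⊙ h × + 2 • y″ ≡ + 2 • y′ ⊕ y ⊙ h

    -- Right linearity of `B u`, together with `B u u = F u`, a real scalar because `conj x ⊙ x` is
    -- the norm.
    B-shear : ∀ u v v′ {h} → Shear u v v′ h → + 2 • B u v′ ≡ + 2 • B u v ⊕ F u • h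
    B-shear (x , y) (x′ , y′) (x″ , y″) {h} (ex , ey) = ext
      (combine (c₀ X) (c₀ Y) (c₀ X′) (c₀ Y′) (c₀ h) (cong c₀ hx) (cong c₀ hy))
      (combine (c₁ X) (c₁ Y) (c₁ X′) (c₁ Y′) (c₁ h) (cong c₁ hx) (cong c₁ hy))
      (combine (c₂ X) (c₂ Y) (c₂ X′) (c₂ Y′) (c₂ h) (cong c₂ hx) (cong c₂ hy))
      (combine (c₃ X) (c₃ Y) (c₃ X′) (c₃ Y′) (c₃ h) (cong c₃ hx) (cong c₃ hy))
      where
      X = conj x ⊙ x″
      X′ = conj x ⊙ x′
      Y = conj y ⊙ y″
      Y′ = conj y ⊙ y′
      half-shear : ∀ x x′ x″ → + 2 • x″ ≡ + 2 • x′ ⊕ x ⊙ h →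
        + 2 • (conj x ⊙ x″) ≡ + 2 • (conj x ⊙ x′) ⊕ norm x • h
      half-shear x x′ x″ e = begin
        + 2 • (conj x ⊙ x″)                          ≡⟨ ⊙-• (conj x) (+ 2) x″ ⟨
        conj x ⊙ (+ 2 • x″)                          ≡⟨ cong (conj x ⊙_) e ⟩
        conj x ⊙ (+ 2 • x′ ⊕ x ⊙ h)                  ≡⟨ ⊙-linear (conj x) (+ 2) x′ (x ⊙ h) ⟩
        + 2 • (conj x ⊙ x′) ⊕ conj x ⊙ (x ⊙ h)       ≡⟨ cong (+ 2 • (conj x ⊙ x′) ⊕_) (conj-⊙-⊙ x h) ⟩
        + 2 • (conj x ⊙ x′) ⊕ norm x • h             ∎
        where open ≡-Reasoning
      hx = half-shear x x′ x″ ex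
      hy = half-shear y y′ y″ ey
      combine : ∀ a c a′ c′ h {m n} → + 2 * a ≡ + 2 * a′ + m * h → + 2 * c ≡ + 2 * c′ + n * h →
        + 2 * (s * a + t * c) ≡ + 2 * (s * a′ + t * c′) + (s * m + t * n) * h
      combine a c a′ c′ h {m} {n} ea ec = begin
        + 2 * (s * a + t * c)
          ≡⟨ solve 4 (λ s t a c → con (+ 2) :* (s :* a :+ t :* c)
               := s :* (con (+ 2) :* a) :+ t :* (con (+ 2) :* c)) refl s t a c ⟩
        s * (+ 2 * a) + t * (+ 2 * c)
          ≡⟨ cong₂ (λ i j → s * i + t * j) ea ec ⟩
        s * (+ 2 * a′ + m * h) + t * (+ 2 * c′ + n * h)
          ≡⟨ solve 7 (λ s t a c h m n →
               s :* (con (+ 2) :* a :+ m :* h) :+ t :* (con (+ 2) :* c :+ n :* h)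
                 := con (+ 2) :* (s :* a :+ t :* c) :+ (s :* m :+ t :* n) :* h)
               refl s t a′ c′ h m n ⟩
        + 2 * (s * a′ + t * c′) + (s * m + t * n) * h ∎
        where open ≡-Reasoning

    -- Expansion of the form at v + u·(h/2); the factor 4 clears the squared halves.
    F-shear : ∀ u v v′ {h} → Shear u v v′ h →
      + 4 * F v′ ≡ + 4 * F v + + 4 * dot (B u v) h + F u * norm h
    F-shear (x , y) (x′ , y′) (x″ , y″) {h} (ex , ey) = begin
      + 4 * (s * norm x″ + t * norm y″)
        ≡⟨ solve 4 (λ s t a c → con (+ 4) :* (s :* a :+ t :* c)
             := s :* (con (+ 4) :* a) :+ t :* (con (+ 4) :* c)) refl s t (norm x″) (norm y″) ⟩
      s * (+ 4 * norm x″) + t * (+ 4 * norm y″)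
        ≡⟨ cong₂ (λ i j → s * i + t * j) (norm-shear x x′ x″ ex) (norm-shear y y′ y″ ey) ⟩
      s * (+ 4 * norm x′ + + 4 * dot X h + norm x * norm h)
        + t * (+ 4 * norm y′ + + 4 * dot Y h + norm y * norm h)
        ≡⟨ solve 9 (λ s t a b c a′ b′ c′ h →
             s :* (con (+ 4) :* a :+ con (+ 4) :* b :+ c :* h)
               :+ t :* (con (+ 4) :* a′ :+ con (+ 4) :* b′ :+ c′ :* h)
             := con (+ 4) :* (s :* a :+ t :* a′) :+ con (+ 4) :* (s :* b :+ t :* b′)
               :+ (s :* c :+ t :* c′) :* h)
             refl s t (norm x′) (dot X h) (norm x) (norm y′) (dot Y h) (norm y) (norm h) ⟩
      + 4 * F (x′ , y′) + + 4 * (s * dot X h + t * dot Y h) + F (x , y) * norm h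
        ≡⟨ cong (λ i → + 4 * F (x′ , y′) + + 4 * i + F (x , y) * norm h) (dot-linear s X t Y h) ⟨
      + 4 * F (x′ , y′) + + 4 * dot (B (x , y) (x′ , y′)) h + F (x , y) * norm h ∎
      where
      open ≡-Reasoning
      X = conj x ⊙ x′
      Y = conj y ⊙ y′
      norm-shear : ∀ x x′ x″ → + 2 • x″ ≡ + 2 • x′ ⊕ x ⊙ h →
        + 4 * norm x″ ≡ + 4 * norm x′ + + 4 * dot (conj x ⊙ x′) h + norm x * norm h
      norm-shear x x′ x″ e = begin
        + 4 * norm x″                      ≡⟨ norm-• (+ 2) x″ ⟨
        norm (+ 2 • x″)                    ≡⟨ cong norm e ⟩
        norm (+ 2 • x′ ⊕ x ⊙ h)            ≡⟨ norm-2•-⊕ x′ (x ⊙ h) ⟩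
        + 4 * norm x′ + + 4 * dot x′ (x ⊙ h) + norm (x ⊙ h)
          ≡⟨ cong₂ (λ i j → + 4 * norm x′ + + 4 * i + j) (dot-⊙ x x′ h) (norm-⊙ x h) ⟩
        + 4 * norm x′ + + 4 * dot (conj x ⊙ x′) h + norm x * norm h ∎

    -- F u F v − |B u v|² is the Gram determinant of (u, v).
    gram-shear : ∀ u v v′ {h D} → Shear u v v′ h →
      F u * F v ≡ D + norm (B u v) → F u * F v′ ≡ D + norm (B u v′)
    gram-shear u v v′ {h} {D} sh g = ℤₚ.*-cancelˡ-≡ (+ 4) (F u * F v′) (D + norm (B u v′)) (begin
      + 4 * (a * F v′)
        ≡⟨ solve 2 (λ a c → con (+ 4) :* (a :* c) := a :* (con (+ 4) :* c)) refl a (F v′) ⟩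
      a * (+ 4 * F v′)
        ≡⟨ cong (a *_) (F-shear u v v′ sh) ⟩
      a * (+ 4 * F v + + 4 * dot b h + a * norm h)
        ≡⟨ solve 4 (λ a c d n → a :* (con (+ 4) :* c :+ con (+ 4) :* d :+ a :* n)
             := con (+ 4) :* (a :* c) :+ (con (+ 4) :* (a :* d) :+ a :* a :* n))
             refl a (F v) (dot b h) (norm h) ⟩
      + 4 * (a * F v) + (+ 4 * (a * dot b h) + a * a * norm h)
        ≡⟨ cong (λ i → + 4 * i + (+ 4 * (a * dot b h) + a * a * norm h)) g ⟩
      + 4 * (D + norm b) + (+ 4 * (a * dot b h) + a * a * norm h)
        ≡⟨ solve 4 (λ D n d k → con (+ 4) :* (D :+ n) :+ (con (+ 4) :* d :+ k)
             := con (+ 4) :* D :+ (con (+ 4) :* n :+ con (+ 4) :* d :+ k))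
             refl D (norm b) (a * dot b h) (a * a * norm h) ⟩
      + 4 * D + (+ 4 * norm b + + 4 * (a * dot b h) + a * a * norm h)
        ≡⟨ cong (λ i → + 4 * D + i) norm-b′ ⟨
      + 4 * D + + 4 * norm b′
        ≡⟨ ℤₚ.*-distribˡ-+ (+ 4) D (norm b′) ⟨
      + 4 * (D + norm b′) ∎)
      where
      open ≡-Reasoning
      a = F u
      b = B u v
      b′ = B u v′
      norm-b′ : + 4 * norm b′ ≡ + 4 * norm b + + 4 * (a * dot b h) + a * a * norm h
      norm-b′ = begin
        + 4 * norm b′             ≡⟨ norm-• (+ 2) b′ ⟨
        norm (+ 2 • b′)           ≡⟨ cong norm (B-shear u v v′ sh) ⟩
        norm (+ 2 • b ⊕ a • h)    ≡⟨ norm-2•-⊕ b (a • h) ⟩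
        + 4 * norm b + + 4 * dot b (a • h) + norm (a • h)
          ≡⟨ cong₂ (λ i j → + 4 * norm b + + 4 * i + j) (dot-• a b h) (norm-• a h) ⟩
        + 4 * norm b + + 4 * (a * dot b h) + a * a * norm h ∎

-- Hurwitz integers, rounding and Gauss reduction

module Reduction where
  open import Data.Integer.Base using (_+_; _*_; -_; _-_; _≤_; _<_; 0ℤ)
  open ℤSolver
  open IntegerForms
  private
    module P {n} = QuatOps {Polynomial n} _:+_ _:*_ :-_

  -- ⟪ e , f , g , h ⟫ stands for the Hurwitz integer eω + fi + gj + hk with
  -- ω = (1 + i + j + k)/2, and dbl is twice that quaternion.
  dbl : Quat ℤ → Quat ℤ
  dbl ⟪ e , f , g , h ⟫ = ⟪ e , e + + 2 * f , e + + 2 * g , e + + 2 * h ⟫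

  -- The product in the basis ω, i, j, k. Since 1 is not a basis element, real parts enter through
  -- -1 = -2ω + i + j + k: this gives ω² = -ω + i + j + k and the terms with `S`.
  _∘_ : Quat ℤ → Quat ℤ → Quat ℤ
  ⟪ e , f , g , h ⟫ ∘ ⟪ e′ , f′ , g′ , h′ ⟫ =
    ⟪ - (e * e′ + (e * f′ + f * e′) + (e * g′ + g * e′) + (e * h′ + h * e′) + + 2 * S)
    , e * e′ + (e * f′ + f * e′) + (e * h′ + g * e′) + (g * h′ - h * g′) + S
    , e * e′ + (e * g′ + g * e′) + (e * f′ + h * e′) + (h * f′ - f * h′) + S
    , e * e′ + (e * h′ + h * e′) + (e * g′ + f * e′) + (f * g′ - g * f′) + S ⟫
    where S = f * f′ + g * g′ + h * h′

  -- Closure of the Hurwitz order under multiplication, which keeps sheared vectors inside the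
  -- lattice.
  dbl-∘ : ∀ x y → dbl x ⊙ dbl y ≡ + 2 • dbl (x ∘ y)
  dbl-∘ ⟪ e , f , g , h ⟫ ⟪ e′ , f′ , g′ , h′ ⟫ = ext
    (solve 8 (law c₀) refl e f g h e′ f′ g′ h′)
    (solve 8 (law c₁) refl e f g h e′ f′ g′ h′)
    (solve 8 (law c₂) refl e f g h e′ f′ g′ h′)
    (solve 8 (law c₃) refl e f g h e′ f′ g′ h′)
    where
    law : ∀ {n} → (∀ {A} → Quat A → A) → (_ _ _ _ _ _ _ _ : Polynomial n) → _
    law π e f g h e′ f′ g′ h′ =
      let two = con (+ 2)
          dblₚ : Quat _ → Quat _
          dblₚ = λ { ⟪ e , f , g , h ⟫ → ⟪ e , e :+ two :* f , e :+ two :* g , e :+ two :* h ⟫ }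
          S = f :* f′ :+ g :* g′ :+ h :* h′
          x∘y = ⟪ :- (e :* e′ :+ (e :* f′ :+ f :* e′) :+ (e :* g′ :+ g :* e′) :+ (e :* h′ :+ h :* e′) :+ two :* S)
                , e :* e′ :+ (e :* f′ :+ f :* e′) :+ (e :* h′ :+ g :* e′) :+ (g :* h′ :- h :* g′) :+ S
                , e :* e′ :+ (e :* g′ :+ g :* e′) :+ (e :* f′ :+ h :* e′) :+ (h :* f′ :- f :* h′) :+ S
                , e :* e′ :+ (e :* h′ :+ h :* e′) :+ (e :* g′ :+ f :* e′) :+ (f :* g′ :- g :* f′) :+ S ⟫
      in π (dblₚ ⟪ e , f , g , h ⟫ P.⊙ dblₚ ⟪ e′ , f′ , g′ , h′ ⟫) := π (two P.• dblₚ x∘y)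

  dbl-⊕ : ∀ x y → dbl (x ⊕ y) ≡ dbl x ⊕ dbl y
  dbl-⊕ ⟪ e , f , g , h ⟫ ⟪ e′ , f′ , g′ , h′ ⟫ = ext refl (add f f′) (add g g′) (add h h′)
    where
    add : ∀ f f′ → (e + e′) + + 2 * (f + f′) ≡ (e + + 2 * f) + (e′ + + 2 * f′)
    add = solve 4 (λ e e′ f f′ → (e :+ e′) :+ con (+ 2) :* (f :+ f′)
      := (e :+ con (+ 2) :* f) :+ (e′ :+ con (+ 2) :* f′)) refl e e′

  private
    sq : ℤ → ℤ
    sq i = i * i

    sqₚ : ∀ {n} → Polynomial n → Polynomial n
    sqₚ p = p :* p

  -- Modulo 2a, 2b = ±r with 0 ≤ r ≤ a; so the nearest even and the nearest odd
  -- multiple of a lie at distances r and a − r, and r² + (a − r)² ≤ a².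
  round : ∀ b a → 0ℤ < a → ∃[ k ] ∃[ l ]
    sq (+ 2 * b + a * (+ 2 * k)) + sq (+ 2 * b + a * (+ 1 + + 2 * l)) ≤ sq a
  round b (+ zero) (ℤ.+<+ ())
  round b a@(+ suc n) _ =
    subst (λ b → ∃[ k ] ∃[ l ] sq (+ 2 * b + a * (+ 2 * k)) + sq (+ 2 * b + a * (+ 1 + + 2 * l)) ≤ sq a)
      (sym (ℤDivMod.a≡a%ℕn+[a/ℕn]*n b (suc n)))
      (round-remainder (+ (b ℤ.%ℕ suc n)) (b ℤ./ℕ suc n) (ℤ.+≤+ ℕ.z≤n)
        (ℤ.+≤+ (ℕₚ.<⇒≤ (ℤDivMod.n%ℕd<d b (suc n)))))
    where
    round-remainder : ∀ r q → 0ℤ ≤ r → r ≤ a → ∃[ k ] ∃[ l ]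
      sq (+ 2 * (r + q * a) + a * (+ 2 * k)) + sq (+ 2 * (r + q * a) + a * (+ 1 + + 2 * l)) ≤ sq a
    -- Here `r` is the remainder of `b` modulo `a`. Adding an even multiple of `a` leaves 2r or 2r -
    -- 2a, an odd one 2r - a in both cases. The slack factors as 4r(a - 2r) or 4(a - r)(2r - a).
    round-remainder r q 0≤r r≤a with ℤₚ.≤-total (+ 2 * r) a
    ... | inj₁ 2r≤a = - q , - q - + 1 , ℤₚ.0≤i-j⇒j≤i (subst (0ℤ ≤_)
      (solve 3 (λ r q a → con (+ 4) :* (r :* (a :- con (+ 2) :* r))
        := sqₚ a :- (sqₚ (con (+ 2) :* (r :+ q :* a) :+ a :* (con (+ 2) :* :- q))
          :+ sqₚ (con (+ 2) :* (r :+ q :* a) :+ a :* (con (+ 1) :+ con (+ 2) :* (:- q :- con (+ 1))))))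
        refl r q a)
      (*-nonNeg {+ 4} (ℤ.+≤+ ℕ.z≤n) (*-nonNeg 0≤r (ℤₚ.i≤j⇒0≤j-i 2r≤a))))
    ... | inj₂ a≤2r = - q - + 1 , - q - + 1 , ℤₚ.0≤i-j⇒j≤i (subst (0ℤ ≤_)
      (solve 3 (λ r q a → con (+ 4) :* ((a :- r) :* (con (+ 2) :* r :- a))
        := sqₚ a :- (sqₚ (con (+ 2) :* (r :+ q :* a) :+ a :* (con (+ 2) :* (:- q :- con (+ 1))))
          :+ sqₚ (con (+ 2) :* (r :+ q :* a) :+ a :* (con (+ 1) :+ con (+ 2) :* (:- q :- con (+ 1))))))
        refl r q a)
      (*-nonNeg {+ 4} (ℤ.+≤+ ℕ.z≤n) (*-nonNeg (ℤₚ.i≤j⇒0≤j-i r≤a) (ℤₚ.i≤j⇒0≤j-i a≤2r))))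

  -- Rounding b/a to integers and to half-integers gives two squared errors with
  -- sum at most 1, so one of them is at most 1/2.
  hurwitz-round : ∀ b a → 0ℤ < a → ∃[ h ] norm (+ 2 • b ⊕ a • dbl h) ≤ + 2 * (a * a)
  hurwitz-round b@(⟪ b₀ , b₁ , b₂ , b₃ ⟫) a 0<a
    with round b₀ a 0<a | round b₁ a 0<a | round b₂ a 0<a | round b₃ a 0<a
  ... | k₀ , l₀ , e₀ | k₁ , l₁ , e₁ | k₂ , l₂ , e₂ | k₃ , l₃ , e₃
    with ℤₚ.≤-total (norm (+ 2 • b ⊕ a • whole)) (+ 2 * (a * a))
    where
    whole = ⟪ + 2 * k₀ , + 2 * k₁ , + 2 * k₂ , + 2 * k₃ ⟫
  -- In the ω basis, k₀ + k₁i + k₂j + k₃k has e = 2k₀; the k₀ that 2k₀ω puts on i, j and k is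
  -- subtracted again.
  ... | inj₁ le = ⟪ + 2 * k₀ , k₁ - k₀ , k₂ - k₀ , k₃ - k₀ ⟫ ,
    subst (λ h → norm (+ 2 • b ⊕ a • h) ≤ + 2 * (a * a)) (ext refl (even k₁) (even k₂) (even k₃)) le
    where
    even : ∀ k → + 2 * k ≡ + 2 * k₀ + + 2 * (k - k₀)
    even k = solve 2 (λ k₀ k → con (+ 2) :* k := con (+ 2) :* k₀ :+ con (+ 2) :* (k :- k₀)) refl k₀ k
  ... | inj₂ ge = ⟪ + 1 + + 2 * l₀ , l₁ - l₀ , l₂ - l₀ , l₃ - l₀ ⟫ ,
    subst (λ h → norm (+ 2 • b ⊕ a • h) ≤ + 2 * (a * a)) (ext refl (odd l₁) (odd l₂) (odd l₃)) le
    where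
    odd : ∀ l → + 1 + + 2 * l ≡ (+ 1 + + 2 * l₀) + + 2 * (l - l₀)
    odd l = solve 2 (λ l₀ l → con (+ 1) :+ con (+ 2) :* l
      := (con (+ 1) :+ con (+ 2) :* l₀) :+ con (+ 2) :* (l :- l₀)) refl l₀ l
    whole = ⟪ + 2 * k₀ , + 2 * k₁ , + 2 * k₂ , + 2 * k₃ ⟫
    half = ⟪ + 1 + + 2 * l₀ , + 1 + + 2 * l₁ , + 1 + + 2 * l₂ , + 1 + + 2 * l₃ ⟫
    W = norm (+ 2 • b ⊕ a • whole)
    H = norm (+ 2 • b ⊕ a • half)
    W+H≤4a² : W + H ≤ + 4 * (a * a)
    W+H≤4a² = subst₂ _≤_
      (solve 8 (λ w₀ w₁ w₂ w₃ h₀ h₁ h₂ h₃ →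
        (w₀ :+ h₀) :+ (w₁ :+ h₁) :+ (w₂ :+ h₂) :+ (w₃ :+ h₃)
          := (w₀ :+ w₁ :+ w₂ :+ w₃) :+ (h₀ :+ h₁ :+ h₂ :+ h₃)) refl
        (sq (+ 2 * b₀ + a * (+ 2 * k₀))) (sq (+ 2 * b₁ + a * (+ 2 * k₁)))
        (sq (+ 2 * b₂ + a * (+ 2 * k₂))) (sq (+ 2 * b₃ + a * (+ 2 * k₃)))
        (sq (+ 2 * b₀ + a * (+ 1 + + 2 * l₀))) (sq (+ 2 * b₁ + a * (+ 1 + + 2 * l₁)))
        (sq (+ 2 * b₂ + a * (+ 1 + + 2 * l₂))) (sq (+ 2 * b₃ + a * (+ 1 + + 2 * l₃))))
      (solve 1 (λ m → m :+ m :+ m :+ m := con (+ 4) :* m) refl (a * a))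
      (ℤₚ.+-mono-≤ (ℤₚ.+-mono-≤ (ℤₚ.+-mono-≤ e₀ e₁) e₂) e₃)
    le : H ≤ + 2 * (a * a)
    le = ℤₚ.0≤i-j⇒j≤i (subst (0ℤ ≤_)
      (solve 3 (λ w h m → (con (+ 4) :* m :- (w :+ h)) :+ (w :- con (+ 2) :* m) := con (+ 2) :* m :- h)
        refl W H (a * a))
      (ℤₚ.+-mono-≤ (ℤₚ.i≤j⇒0≤j-i W+H≤4a²) (ℤₚ.i≤j⇒0≤j-i ge)))

  -- The reduction carries lattice elements `L` and evaluates the form on them through `φ`, so its
  -- output is again a lattice element. `D` is the Gram determinant, unchanged by shears.
  module Descent (s t D : ℤ) (0<D : 0ℤ < D)
    {L : Set} (φ : L → Quat ℤ × Quat ℤ) (shear : L → L → Quat ℤ → L)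
    (φ-shear : ∀ u v h → Form.Shear s t (φ u) (φ v) (φ (shear u v h)) (dbl h))
    where
    open Form s t

    -- Gauss reduction: as long as 2D < a², shearing v by a rounding of −b/a makes
    -- F v = (D + |b|²)/a < a, and the two vectors change roles.
    reduce : ∀ n u v → 0ℤ < F (φ u) → F (φ u) ≤ + n →
      F (φ u) * F (φ v) ≡ D + norm (B (φ u) (φ v)) →
      ∃[ w ] 0ℤ < F (φ w) × F (φ w) * F (φ w) ≤ + 2 * D
    reduce zero u v 0<a a≤n _ = contradiction (ℤₚ.<-≤-trans 0<a a≤n) (ℤₚ.<-irrefl refl)
    reduce (suc n) u v 0<a a≤n g with F (φ u) * F (φ u) ℤ.≤? + 2 * D
    ... | yes a²≤2D = u , 0<a , a²≤2D
    -- Termination: `n` bounds the positive integer `F`, which drops strictly with each shear.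
    ... | no  a²≰2D = reduce n v′ u 0<c (<-+suc (ℤₚ.<-≤-trans c<a a≤n))
      (trans (ℤₚ.*-comm c a) (trans g′ (cong (λ i → D + i) (B-comm (φ u) (φ v′)))))
      where
      a = F (φ u)
      h = proj₁ (hurwitz-round (B (φ u) (φ v)) a 0<a)
      v′ = shear u v h
      c = F (φ v′)
      b′ = B (φ u) (φ v′)
      g′ : a * c ≡ D + norm b′
      g′ = gram-shear (φ u) (φ v) (φ v′) {dbl h} {D} (φ-shear u v h) g
      4b′²≤2a² : + 4 * norm b′ ≤ + 2 * (a * a)
      4b′²≤2a² = subst (_≤ + 2 * (a * a))
        (trans (cong norm (sym (B-shear (φ u) (φ v) (φ v′) (φ-shear u v h)))) (norm-• (+ 2) b′))
        (proj₂ (hurwitz-round (B (φ u) (φ v)) a 0<a))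
      <-+suc : ∀ {i} → i < + suc n → i ≤ + n
      <-+suc {i} i<1+n = ℤₚ.i<j⇒i≤pred[j] i<1+n
      0<c : 0ℤ < c
      0<c = ℤₚ.*-cancelˡ-<-nonNeg a {{ℤ.nonNegative (ℤₚ.<⇒≤ 0<a)}}
        (subst₂ _<_ (sym (ℤₚ.*-zeroʳ a)) (sym g′) (ℤₚ.+-mono-<-≤ 0<D (norm-nonNeg b′)))
      4ac<4aa : + 4 * (a * c) < + 4 * (a * a)
      4ac<4aa = begin-strict
        + 4 * (a * c)                         ≡⟨ cong (+ 4 *_) g′ ⟩
        + 4 * (D + norm b′)
          ≡⟨ solve 2 (λ D n → con (+ 4) :* (D :+ n)
               := con (+ 2) :* (con (+ 2) :* D) :+ con (+ 4) :* n) refl D (norm b′) ⟩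
        + 2 * (+ 2 * D) + + 4 * norm b′
          <⟨ ℤₚ.+-mono-<-≤ (ℤₚ.*-monoˡ-<-pos (+ 2) (ℤₚ.≰⇒> a²≰2D)) 4b′²≤2a² ⟩
        + 2 * (a * a) + + 2 * (a * a)
          ≡⟨ solve 1 (λ m → con (+ 2) :* m :+ con (+ 2) :* m := con (+ 4) :* m) refl (a * a) ⟩
        + 4 * (a * a)                         ∎
        where open ℤₚ.≤-Reasoning
      c<a : c < a
      c<a = ℤₚ.*-cancelˡ-<-nonNeg a {{ℤ.nonNegative (ℤₚ.<⇒≤ 0<a)}}
        (ℤₚ.*-cancelˡ-<-nonNeg (+ 4) 4ac<4aa)

  -- The norm of eω + fi + gj + hk. It is an integer even where the components are half-integers.
  hnorm : Quat ℤ → ℤ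
  hnorm ⟪ e , f , g , h ⟫ = e * e + e * f + e * g + e * h + f * f + g * g + h * h

  norm-dbl : ∀ x → norm (dbl x) ≡ + 4 * hnorm x
  norm-dbl ⟪ e , f , g , h ⟫ = solve 4 (λ e f g h →
    let two = con (+ 2) in
    P.norm ⟪ e , e :+ two :* f , e :+ two :* g , e :+ two :* h ⟫
      := con (+ 4) :* (e :* e :+ e :* f :+ e :* g :+ e :* h :+ f :* f :+ g :* g :+ h :* h))
    refl e f g h

  square≤0⇒≡0 : ∀ i → i * i ≤ 0ℤ → i ≡ 0ℤ
  square≤0⇒≡0 i i²≤0 with ℤₚ.i*j≡0⇒i≡0∨j≡0 i (ℤₚ.≤-antisym i²≤0 (square-nonNeg i))
  ... | inj₁ i≡0 = i≡0
  ... | inj₂ i≡0 = i≡0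

  norm≤0⇒≡0 : ∀ x → norm x ≤ 0ℤ → x ≡ ⟪ 0ℤ , 0ℤ , 0ℤ , 0ℤ ⟫
  norm≤0⇒≡0 ⟪ a , b , c , d ⟫ n≤0 = ext
    (zero′ a (≤+ (≤+ (≤+ ℤₚ.≤-refl b) c) d)) (zero′ b (≤+ (≤+ (+≤ a ℤₚ.≤-refl) c) d))
    (zero′ c (≤+ (+≤ₛ (a * a + b * b) (ℤₚ.+-mono-≤ (square-nonNeg a) (square-nonNeg b))) d))
    (zero′ d (+≤ₛ (a * a + b * b + c * c)
      (ℤₚ.+-mono-≤ (ℤₚ.+-mono-≤ (square-nonNeg a) (square-nonNeg b)) (square-nonNeg c))))
    where
    zero′ : ∀ i → i * i ≤ norm ⟪ a , b , c , d ⟫ → i ≡ 0ℤ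
    zero′ i i²≤ = square≤0⇒≡0 i (ℤₚ.≤-trans i²≤ n≤0)
    ≤+ : ∀ {i j} → i ≤ j → ∀ k → i ≤ j + k * k
    ≤+ {i} {j} i≤j k = subst (_≤ j + k * k) (ℤₚ.+-identityʳ i) (ℤₚ.+-mono-≤ i≤j (square-nonNeg k))
    +≤ₛ : ∀ {i} j → 0ℤ ≤ j → i ≤ j + i
    +≤ₛ {i} j 0≤j = subst (_≤ j + i) (ℤₚ.+-identityˡ i) (ℤₚ.+-monoˡ-≤ i 0≤j)
    +≤ : ∀ k {i j} → i ≤ j → i ≤ k * k + j
    +≤ k {i} {j} i≤j = ℤₚ.≤-trans i≤j (+≤ₛ (k * k) (square-nonNeg k))

  square-cancel-≤ : ∀ i j → 0ℤ ≤ i → 0ℤ ≤ j → i * i ≤ j * j → i ≤ j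
  square-cancel-≤ i j 0≤i 0≤j i²≤j² = ℤₚ.≮⇒≥ λ j<i → ℤₚ.<-irrefl refl (ℤₚ.≤-<-trans i²≤j²
    (ℤₚ.≤-<-trans (ℤₚ.*-monoˡ-≤-nonNeg j {{ℤ.nonNegative 0≤j}} (ℤₚ.<⇒≤ j<i))
      (ℤₚ.*-monoʳ-<-pos i {{ℤ.positive (ℤₚ.≤-<-trans 0≤j j<i)}} j<i)))

  private
    -- 1 = 2ω - i - j - k.
    0q 1q : Quat ℤ
    0q = ⟪ + 0 , + 0 , + 0 , + 0 ⟫
    1q = ⟪ + 2 , -[1+ 0 ] , -[1+ 0 ] , -[1+ 0 ] ⟫

  -- The lattice of pairs (q, ξq - p) and Dirichlet approximation for ξ = X/d

  module Lattice (X : Quat ℤ) (d : ℤ) where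

    -- This is 2d(ξq - p) for ξ = X/d.
    remainder : Quat ℤ → Quat ℤ → Quat ℤ
    remainder q p = X ⊙ dbl q ⊖ d • dbl p

    φ : Quat ℤ × Quat ℤ → Quat ℤ × Quat ℤ
    φ (q , p) = dbl q , remainder q p

    shear : Quat ℤ × Quat ℤ → Quat ℤ × Quat ℤ → Quat ℤ → Quat ℤ × Quat ℤ
    shear (q , p) (q′ , p′) h = q′ ⊕ q ∘ h , p′ ⊕ p ∘ h

    dbl-shear : ∀ x y h → + 2 • dbl (y ⊕ x ∘ h) ≡ + 2 • dbl y ⊕ dbl x ⊙ dbl h
    dbl-shear x y h = begin
      + 2 • dbl (y ⊕ x ∘ h)                ≡⟨ cong (+ 2 •_) (dbl-⊕ y (x ∘ h)) ⟩
      + 2 • (dbl y ⊕ dbl (x ∘ h))          ≡⟨ •-⊕ (dbl y) (dbl (x ∘ h)) ⟩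
      + 2 • dbl y ⊕ + 2 • dbl (x ∘ h)      ≡⟨ cong (+ 2 • dbl y ⊕_) (dbl-∘ x h) ⟨
      + 2 • dbl y ⊕ dbl x ⊙ dbl h          ∎
      where
      open ≡-Reasoning
      •-⊕ : ∀ x y → + 2 • (x ⊕ y) ≡ + 2 • x ⊕ + 2 • y
      •-⊕ x y = ext (ℤₚ.*-distribˡ-+ (+ 2) (c₀ x) (c₀ y)) (ℤₚ.*-distribˡ-+ (+ 2) (c₁ x) (c₁ y))
        (ℤₚ.*-distribˡ-+ (+ 2) (c₂ x) (c₂ y)) (ℤₚ.*-distribˡ-+ (+ 2) (c₃ x) (c₃ y))

    -- The remainder is right linear in (q, p): `X` multiplies from the left and the integer `d` is
    -- central.
    remainder-shear : ∀ q p q′ p′ h →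
      + 2 • remainder (q′ ⊕ q ∘ h) (p′ ⊕ p ∘ h) ≡ + 2 • remainder q′ p′ ⊕ remainder q p ⊙ dbl h
    remainder-shear q p q′ p′ h = begin
      + 2 • (X ⊙ dbl q″ ⊖ d • dbl p″)
        ≡⟨ •-⊖-• (X ⊙ dbl q″) (dbl p″) ⟩
      + 2 • (X ⊙ dbl q″) ⊖ d • (+ 2 • dbl p″)
        ≡⟨ cong₂ (λ x y → x ⊖ d • y) X⊙-shear (dbl-shear p p′ h) ⟩
      (+ 2 • (X ⊙ dbl q′) ⊕ (X ⊙ dbl q) ⊙ dbl h) ⊖ d • (+ 2 • dbl p′ ⊕ dbl p ⊙ dbl h)
        ≡⟨ regroup (X ⊙ dbl q′) (X ⊙ dbl q) (dbl h) (dbl p′) (dbl p) ⟩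
      + 2 • remainder q′ p′ ⊕ remainder q p ⊙ dbl h ∎
      where
      open ≡-Reasoning
      q″ = q′ ⊕ q ∘ h
      p″ = p′ ⊕ p ∘ h
      X⊙-shear : + 2 • (X ⊙ dbl q″) ≡ + 2 • (X ⊙ dbl q′) ⊕ (X ⊙ dbl q) ⊙ dbl h
      X⊙-shear = begin
        + 2 • (X ⊙ dbl q″)                                ≡⟨ ⊙-• X (+ 2) (dbl q″) ⟨
        X ⊙ (+ 2 • dbl q″)                                ≡⟨ cong (X ⊙_) (dbl-shear q q′ h) ⟩
        X ⊙ (+ 2 • dbl q′ ⊕ dbl q ⊙ dbl h)                ≡⟨ ⊙-linear X (+ 2) (dbl q′) (dbl q ⊙ dbl h) ⟩
        + 2 • (X ⊙ dbl q′) ⊕ X ⊙ (dbl q ⊙ dbl h)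
          ≡⟨ cong (+ 2 • (X ⊙ dbl q′) ⊕_) (⊙-assoc X (dbl q) (dbl h)) ⟨
        + 2 • (X ⊙ dbl q′) ⊕ (X ⊙ dbl q) ⊙ dbl h          ∎
      •-⊖-• : ∀ x y → + 2 • (x ⊖ d • y) ≡ + 2 • x ⊖ d • (+ 2 • y)
      •-⊖-• x y = ext (law (c₀ x) (c₀ y)) (law (c₁ x) (c₁ y)) (law (c₂ x) (c₂ y)) (law (c₃ x) (c₃ y))
        where
        law : ∀ i j → + 2 * (i - d * j) ≡ + 2 * i - d * (+ 2 * j)
        law = solve 3 (λ d i j → con (+ 2) :* (i :- d :* j) := con (+ 2) :* i :- d :* (con (+ 2) :* j)) refl d
      regroup : ∀ x y h p′ p →
        (+ 2 • x ⊕ y ⊙ h) ⊖ d • (+ 2 • p′ ⊕ p ⊙ h) ≡ + 2 • (x ⊖ d • p′) ⊕ (y ⊖ d • p) ⊙ h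
      regroup ⟪ x₀ , x₁ , x₂ , x₃ ⟫ ⟪ y₀ , y₁ , y₂ , y₃ ⟫ ⟪ h₀ , h₁ , h₂ , h₃ ⟫
        ⟪ r₀ , r₁ , r₂ , r₃ ⟫ ⟪ p₀ , p₁ , p₂ , p₃ ⟫ = ext
        (solve 15 (law c₀) refl d x₀ r₀ y₀ y₁ y₂ y₃ h₀ h₁ h₂ h₃ p₀ p₁ p₂ p₃)
        (solve 15 (law c₁) refl d x₁ r₁ y₀ y₁ y₂ y₃ h₀ h₁ h₂ h₃ p₀ p₁ p₂ p₃)
        (solve 15 (law c₂) refl d x₂ r₂ y₀ y₁ y₂ y₃ h₀ h₁ h₂ h₃ p₀ p₁ p₂ p₃)
        (solve 15 (law c₃) refl d x₃ r₃ y₀ y₁ y₂ y₃ h₀ h₁ h₂ h₃ p₀ p₁ p₂ p₃)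
        where
        law : ∀ {n} → (∀ {A} → Quat A → A) → (_ _ _ _ _ _ _ _ _ _ _ _ _ _ _ : Polynomial n) → _
        law π d x r y₀ y₁ y₂ y₃ h₀ h₁ h₂ h₃ p₀ p₁ p₂ p₃ =
          let y = ⟪ y₀ , y₁ , y₂ , y₃ ⟫; h = ⟪ h₀ , h₁ , h₂ , h₃ ⟫; p = ⟪ p₀ , p₁ , p₂ , p₃ ⟫ in
          (con (+ 2) :* x :+ π (y P.⊙ h)) :- d :* (con (+ 2) :* r :+ π (p P.⊙ h))
            := con (+ 2) :* (x :- d :* r) :+ π ((y P.⊖ d P.• p) P.⊙ h)

    -- The basis vectors map to (0, -2d) and (2, 2X). The terms with |X|² cancel against |B|²,
    -- leaving st·|2 · 2d|².
    initial-gram : ∀ s t → let open Form s t in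
      F (φ (0q , 1q)) * F (φ (1q , 0q))
        ≡ + 16 * (s * t * (d * d)) + norm (B (φ (0q , 1q)) (φ (1q , 0q)))
    initial-gram s t = solve 7 (λ s t d a b c e →
      let X = ⟪ a , b , c , e ⟫
          0ₚ = ⟪ con (+ 0) , con (+ 0) , con (+ 0) , con (+ 0) ⟫
          2ₚ = ⟪ con (+ 2) , con (+ 0) , con (+ 0) , con (+ 0) ⟫
          y = X P.⊙ 0ₚ P.⊖ d P.• 2ₚ
          y′ = X P.⊙ 2ₚ P.⊖ d P.• 0ₚ
      in (s :* P.norm 0ₚ :+ t :* P.norm y) :* (s :* P.norm 2ₚ :+ t :* P.norm y′)
           := con (+ 16) :* (s :* t :* (d :* d))
             :+ P.norm (s P.• (P.conj 0ₚ P.⊙ 2ₚ) P.⊕ t P.• (P.conj y P.⊙ y′)))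
      refl s t d (c₀ X) (c₁ X) (c₂ X) (c₃ X)

    initial-F : ∀ s t → Form.F s t (φ (0q , 1q)) ≡ + 4 * (t * (d * d))
    initial-F s t = solve 7 (λ s t d a b c e →
      let X = ⟪ a , b , c , e ⟫
          0ₚ = ⟪ con (+ 0) , con (+ 0) , con (+ 0) , con (+ 0) ⟫
          2ₚ = ⟪ con (+ 2) , con (+ 0) , con (+ 0) , con (+ 0) ⟫
      in s :* P.norm 0ₚ :+ t :* P.norm (X P.⊙ 0ₚ P.⊖ d P.• 2ₚ) := con (+ 4) :* (t :* (d :* d)))
      refl s t d (c₀ X) (c₁ X) (c₂ X) (c₃ X)

  -- As the remainder is 2d(ξq - p), the last bound is N²|ξq - p|² ≤ 2.
  dirichlet : ∀ X d N → 0ℤ < d → + 1 < N → let open Lattice X d in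
    ∃[ q ] ∃[ p ] 0ℤ < hnorm q × hnorm q ≤ N * N × N * N * norm (remainder q p) ≤ + 8 * (d * d)
  dirichlet X d N 0<d 1<N = q , p , 0<q , q≤N² , r≤
    where
    open Lattice X d
    -- F w = 4d²(2|q|² + N⁴|ξq − p|²) for ξ = X/d, and 2D = M².
    s = + 2 * (d * d)
    t = N * N * (N * N)
    D = + 16 * (s * t * (d * d))
    M = + 8 * (d * d) * (N * N)
    0<N : 0ℤ < N
    0<N = ℤₚ.<-trans (ℤ.+<+ (ℕ.s≤s ℕ.z≤n)) 1<N
    0<dd = *-pos 0<d 0<d
    0<NN = *-pos 0<N 0<N
    0<s = *-pos {+ 2} (ℤ.+<+ (ℕ.s≤s ℕ.z≤n)) 0<dd
    0<t = *-pos 0<NN 0<NN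
    0<D : 0ℤ < D
    0<D = *-pos {+ 16} (ℤ.+<+ (ℕ.s≤s ℕ.z≤n)) (*-pos (*-pos 0<s 0<t) 0<dd)
    open Form s t
    φ-shear : ∀ u v h → Shear (φ u) (φ v) (φ (shear u v h)) (dbl h)
    φ-shear (q , p) (q′ , p′) h = dbl-shear q q′ h , remainder-shear q p q′ p′ h
    open Descent s t D 0<D φ shear φ-shear
    u v : Quat ℤ × Quat ℤ
    u = 0q , 1q
    v = 1q , 0q
    0<F : 0ℤ < F (φ u)
    0<F = subst (0ℤ <_) (sym (initial-F s t)) (*-pos {+ 4} (ℤ.+<+ (ℕ.s≤s ℕ.z≤n)) (*-pos 0<t 0<dd))
    result = reduce ℤ.∣ F (φ u) ∣ u v 0<F
      (ℤₚ.≤-reflexive (sym (ℤₚ.0≤i⇒+∣i∣≡i (ℤₚ.<⇒≤ 0<F)))) (initial-gram s t)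
    w = proj₁ result
    q = proj₁ w
    p = proj₂ w
    F≤M : F (φ w) ≤ M
    F≤M = square-cancel-≤ (F (φ w)) M (ℤₚ.<⇒≤ (proj₁ (proj₂ result)))
      (ℤₚ.<⇒≤ (*-pos (*-pos {+ 8} (ℤ.+<+ (ℕ.s≤s ℕ.z≤n)) 0<dd) 0<NN))
      (subst (F (φ w) * F (φ w) ≤_)
        (solve 2 (λ d n → con (+ 2) :* (con (+ 16) :* (con (+ 2) :* d :* (n :* n) :* d))
          := (con (+ 8) :* d :* n) :* (con (+ 8) :* d :* n)) refl (d * d) (N * N))
        (proj₂ (proj₂ result)))
    -- Both summands of `F` are nonnegative, so each alone is at most M = 8d²N².
    sx≤F : s * norm (dbl q) ≤ F (φ w)
    sx≤F = subst (_≤ F (φ w)) (ℤₚ.+-identityʳ _)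
      (ℤₚ.+-monoʳ-≤ (s * norm (dbl q)) (*-nonNeg (ℤₚ.<⇒≤ 0<t) (norm-nonNeg (remainder q p))))
    ty≤F : t * norm (remainder q p) ≤ F (φ w)
    ty≤F = subst (_≤ F (φ w)) (ℤₚ.+-identityˡ _)
      (ℤₚ.+-monoˡ-≤ (t * norm (remainder q p)) (*-nonNeg (ℤₚ.<⇒≤ 0<s) (norm-nonNeg (dbl q))))
    q≤N² : hnorm q ≤ N * N
    q≤N² = ℤₚ.*-cancelˡ-≤-pos (hnorm q) (N * N) (+ 8 * (d * d))
      {{ℤ.positive (*-pos {+ 8} (ℤ.+<+ (ℕ.s≤s ℕ.z≤n)) 0<dd)}}
      (subst (_≤ M) (trans (cong (s *_) (norm-dbl q))
        (solve 2 (λ d m → con (+ 2) :* d :* (con (+ 4) :* m) := con (+ 8) :* d :* m) refl (d * d) (hnorm q)))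
        (ℤₚ.≤-trans sx≤F F≤M))
    r≤ : N * N * norm (remainder q p) ≤ + 8 * (d * d)
    r≤ = ℤₚ.*-cancelˡ-≤-pos (N * N * norm (remainder q p)) (+ 8 * (d * d)) (N * N) {{ℤ.positive 0<NN}}
      (subst₂ _≤_ (ℤₚ.*-assoc (N * N) (N * N) (norm (remainder q p)))
        (ℤₚ.*-comm (+ 8 * (d * d)) (N * N)) (ℤₚ.≤-trans ty≤F F≤M))
    -- If q = 0 then p ≠ 0 and |dp|² ≥ d², too large as N ≥ 2.
    0<q : 0ℤ < hnorm q
    0<q = ℤₚ.≰⇒> λ q≤0 →
      let dbl-q≤0 = subst (_≤ 0ℤ) (sym (norm-dbl q)) (ℤₚ.*-monoˡ-≤-nonNeg (+ 4) q≤0)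
          dbl-q≡0 = norm≤0⇒≡0 (dbl q) dbl-q≤0
          r≡ : norm (remainder q p) ≡ d * d * (+ 4 * hnorm p)
          r≡ = trans (cong (λ x → norm (X ⊙ x ⊖ d • dbl p)) dbl-q≡0)
            (trans (zero-remainder X (dbl p)) (cong (d * d *_) (norm-dbl p)))
          hp≤0 = small (subst (λ n → N * N * n ≤ + 8 * (d * d)) r≡ r≤)
          F≤0 : F (φ w) ≤ 0ℤ
          F≤0 = ℤₚ.+-mono-≤ {s * norm (dbl q)} {0ℤ} {t * norm (remainder q p)} {0ℤ}
            (*≤0 s (ℤₚ.<⇒≤ 0<s) dbl-q≤0)
            (*≤0 t (ℤₚ.<⇒≤ 0<t) (subst (_≤ 0ℤ) (sym r≡)
              (*≤0 (d * d) (ℤₚ.<⇒≤ 0<dd) (ℤₚ.*-monoˡ-≤-nonNeg (+ 4) hp≤0))))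
      in ℤₚ.<-irrefl refl (ℤₚ.<-≤-trans (proj₁ (proj₂ result)) F≤0)
      where
      *≤0 : ∀ i {j} → 0ℤ ≤ i → j ≤ 0ℤ → i * j ≤ 0ℤ
      *≤0 i {j} 0≤i j≤0 = subst (i * j ≤_) (ℤₚ.*-zeroʳ i) (ℤₚ.*-monoˡ-≤-nonNeg i {{ℤ.nonNegative 0≤i}} j≤0)
      zero-remainder : ∀ x y → norm (x ⊙ ⟪ 0ℤ , 0ℤ , 0ℤ , 0ℤ ⟫ ⊖ d • y) ≡ d * d * norm y
      zero-remainder ⟪ x₀ , x₁ , x₂ , x₃ ⟫ ⟪ y₀ , y₁ , y₂ , y₃ ⟫ =
        solve 9 (λ d x₀ x₁ x₂ x₃ y₀ y₁ y₂ y₃ →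
          let y = ⟪ y₀ , y₁ , y₂ , y₃ ⟫; 0ₚ = con (+ 0) in
          P.norm (⟪ x₀ , x₁ , x₂ , x₃ ⟫ P.⊙ ⟪ 0ₚ , 0ₚ , 0ₚ , 0ₚ ⟫ P.⊖ d P.• y) := d :* d :* P.norm y)
          refl d x₀ x₁ x₂ x₃ y₀ y₁ y₂ y₃
      small : N * N * (d * d * (+ 4 * hnorm p)) ≤ + 8 * (d * d) → hnorm p ≤ 0ℤ
      small h = ℤₚ.≮⇒≥ λ 0<p → ℤₚ.<-irrefl refl (begin-strict
        + 8 * (d * d)
          <⟨ ℤₚ.*-monoʳ-<-pos (d * d) {{ℤ.positive 0<dd}} (ℤ.+<+ (ℕₚ.m≤m+n 9 7)) ⟩
        + 16 * (d * d)
          ≤⟨ ℤₚ.*-monoʳ-≤-nonNeg (d * d) {{ℤ.nonNegative (ℤₚ.<⇒≤ 0<dd)}} 16≤ ⟩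
        + 4 * (N * N) * (d * d)
          ≡⟨ solve 2 (λ n d → con (+ 4) :* n :* d := n :* (d :* (con (+ 4) :* con (+ 1)))) refl (N * N) (d * d) ⟩
        N * N * (d * d * (+ 4 * + 1))
          ≤⟨ ℤₚ.*-monoˡ-≤-nonNeg (N * N) {{ℤ.nonNegative (ℤₚ.<⇒≤ 0<NN)}}
               (ℤₚ.*-monoˡ-≤-nonNeg (d * d) {{ℤ.nonNegative (ℤₚ.<⇒≤ 0<dd)}}
                 (ℤₚ.*-monoˡ-≤-nonNeg (+ 4) (ℤₚ.i<j⇒suc[i]≤j 0<p))) ⟩
        N * N * (d * d * (+ 4 * hnorm p))
          ≤⟨ h ⟩
        + 8 * (d * d) ∎)
        where
        open ℤₚ.≤-Reasoning
        2≤N : + 2 ≤ N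
        2≤N = ℤₚ.i<j⇒suc[i]≤j 1<N
        16≤ : + 16 ≤ + 4 * (N * N)
        16≤ = ℤₚ.*-monoˡ-≤-nonNeg (+ 4) (ℤₚ.≤-trans (ℤₚ.*-monoˡ-≤-nonNeg (+ 2) 2≤N)
          (ℤₚ.*-monoʳ-≤-nonNeg N {{ℤ.nonNegative (ℤₚ.<⇒≤ 0<N)}} 2≤N))

-- Integers as rationals

module Embedding where
  emb : ℤ → ℚ
  emb i = i ℚ./ 1

  private
    -- `i / 1` normalises through a gcd and does not compute for a variable `i`; this form does.
    mk : ℤ → ℚ
    mk i = mkℚ i 0 (Coprime.sym (Coprime.1-coprimeTo ℤ.∣ i ∣))

    emb≡mk : ∀ i → emb i ≡ mk i
    emb≡mk i = ℚₚ.↥p/↧p≡p (mk i)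

  emb-+ : ∀ i j → emb (i ℤ.+ j) ≡ emb i ℚ.+ emb j
  emb-+ i j = trans
    (cong emb (sym (cong₂ ℤ._+_ (ℤₚ.*-identityʳ i) (ℤₚ.*-identityʳ j))))
    (sym (cong₂ ℚ._+_ (emb≡mk i) (emb≡mk j)))

  emb-* : ∀ i j → emb (i ℤ.* j) ≡ emb i ℚ.* emb j
  emb-* i j = sym (cong₂ ℚ._*_ (emb≡mk i) (emb≡mk j))

  emb-neg : ∀ i → emb (ℤ.- i) ≡ ℚ.- emb i
  emb-neg i = trans (emb≡mk (ℤ.- i)) (trans (neg i) (cong ℚ.-_ (sym (emb≡mk i))))
    where
    neg : ∀ i → mk (ℤ.- i) ≡ ℚ.- mk i
    neg (+ zero)  = refl
    neg (+ suc n) = refl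
    neg -[1+ n ]  = refl

  emb-mono-≤ : ∀ {i j} → i ℤ.≤ j → emb i ℚ.≤ emb j
  emb-mono-≤ {i} {j} i≤j = subst₂ ℚ._≤_ (sym (emb≡mk i)) (sym (emb≡mk j))
    (ℚ.*≤* (ℤₚ.*-monoʳ-≤-nonNeg (+ 1) i≤j))

  emb-mono-< : ∀ {i j} → i ℤ.< j → emb i ℚ.< emb j
  emb-mono-< {i} {j} i<j = subst₂ ℚ._<_ (sym (emb≡mk i)) (sym (emb≡mk j))
    (ℚ.*<* (ℤₚ.*-monoʳ-<-pos (+ 1) i<j))

  emb-injective : ∀ {i j} → emb i ≡ emb j → i ≡ j
  emb-injective {i} {j} eq = cong ℚ.↥_ (trans (sym (emb≡mk i)) (trans eq (emb≡mk j)))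

  *-↧ : ∀ x → emb (ℚ.↧ x) ℚ.* x ≡ emb (ℚ.↥ x)
  *-↧ x@record{} = trans (cong (ℚ._* x) (emb≡mk (ℚ.↧ x)))
    (trans (ℚₚ.toℚᵘ-injective (ℚᵘₚ.≃-trans (ℚₚ.toℚᵘ-homo-* (mk (ℚ.↧ x)) x) (ℚᵘ.*≡* cross)))
      (sym (emb≡mk (ℚ.↥ x))))
    where
    cross : ℚ.↧ x ℤ.* ℚ.↥ x ℤ.* + 1 ≡ ℚ.↥ x ℤ.* (+ 1 ℤ.* ℚ.↧ x)
    cross = trans (ℤₚ.*-identityʳ _) (trans (ℤₚ.*-comm (ℚ.↧ x) (ℚ.↥ x))
      (cong (ℚ.↥ x ℤ.*_) (sym (ℤₚ.*-identityˡ (ℚ.↧ x)))))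

-- Norm estimates for rational quaternions

module RationalForms where
  open import Data.Rational.Base using (_+_; _*_; -_; _-_; _≤_; _<_)
  open ℚSolver
  open QuatOps _+_ _*_ -_ public
  private
    module P {n} = QuatOps {Polynomial n} _:+_ _:*_ :-_

  0≤j-i⇒i≤j : ∀ {i j} → 0ℚ ≤ j - i → i ≤ j
  0≤j-i⇒i≤j {i} {j} 0≤j-i = subst₂ _≤_ (ℚₚ.+-identityˡ i)
    (solve 2 (λ i j → j :- i :+ i := j) refl i j) (ℚₚ.+-monoˡ-≤ i 0≤j-i)

  i≤j⇒0≤j-i : ∀ {i j} → i ≤ j → 0ℚ ≤ j - i
  i≤j⇒0≤j-i {i} {j} i≤j = subst (_≤ j - i) (ℚₚ.+-inverseʳ i) (ℚₚ.+-monoˡ-≤ (- i) i≤j)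

  *-nonNeg : ∀ {i j} → 0ℚ ≤ i → 0ℚ ≤ j → 0ℚ ≤ i * j
  *-nonNeg {i} {j} 0≤i 0≤j =
    subst (_≤ i * j) (ℚₚ.*-zeroʳ i) (ℚₚ.*-monoˡ-≤-nonNeg i {{ℚ.nonNegative 0≤i}} 0≤j)

  *-pos : ∀ {i j} → 0ℚ < i → 0ℚ < j → 0ℚ < i * j
  *-pos {i} {j} 0<i 0<j =
    subst (_< i * j) (ℚₚ.*-zeroʳ i) (ℚₚ.*-monoʳ-<-pos i {{ℚ.positive 0<i}} 0<j)

  *-mono-≤ : ∀ {i j k l} → 0ℚ ≤ i → 0ℚ ≤ l → i ≤ j → k ≤ l → i * k ≤ j * l
  *-mono-≤ {i} {j} {k} {l} 0≤i 0≤l i≤j k≤l = ℚₚ.≤-trans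
    (ℚₚ.*-monoˡ-≤-nonNeg i {{ℚ.nonNegative 0≤i}} k≤l)
    (ℚₚ.*-monoʳ-≤-nonNeg l {{ℚ.nonNegative 0≤l}} i≤j)

  *-cancel-0≤ : ∀ {i j} → 0ℚ < i → 0ℚ ≤ i * j → 0ℚ ≤ j
  *-cancel-0≤ {i} {j} 0<i 0≤ij =
    ℚₚ.*-cancelˡ-≤-pos i {{ℚ.positive 0<i}} (subst (_≤ i * j) (sym (ℚₚ.*-zeroʳ i)) 0≤ij)

  square-nonNeg : ∀ i → 0ℚ ≤ i * i
  square-nonNeg i with ℚₚ.≤-total 0ℚ i
  ... | inj₁ 0≤i = *-nonNeg 0≤i 0≤i
  ... | inj₂ i≤0 = subst (0ℚ ≤_) (solve 1 (λ i → (:- i) :* (:- i) := i :* i) refl i)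
    (*-nonNeg (ℚₚ.neg-antimono-≤ i≤0) (ℚₚ.neg-antimono-≤ i≤0))

  square-cancel-≤ : ∀ {i j} → 0ℚ ≤ j → i * i ≤ j * j → i ≤ j
  square-cancel-≤ {i} {j} 0≤j i²≤j² = ℚₚ.≮⇒≥ λ j<i → ℚₚ.<-irrefl refl (ℚₚ.≤-<-trans i²≤j²
    (ℚₚ.≤-<-trans (ℚₚ.*-monoˡ-≤-nonNeg j {{ℚ.nonNegative 0≤j}} (ℚₚ.<⇒≤ j<i))
      (ℚₚ.*-monoˡ-<-pos i {{ℚ.positive (ℚₚ.≤-<-trans 0≤j j<i)}} j<i)))

  norm-nonNeg : ∀ x → 0ℚ ≤ norm x
  norm-nonNeg ⟪ a , b , c , d ⟫ =
    ℚₚ.+-mono-≤ (ℚₚ.+-mono-≤ (ℚₚ.+-mono-≤ (square-nonNeg a) (square-nonNeg b))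
      (square-nonNeg c)) (square-nonNeg d)

  norm-⊙ : ∀ x y → norm (x ⊙ y) ≡ norm x * norm y
  norm-⊙ ⟪ a , b , c , d ⟫ ⟪ a′ , b′ , c′ , d′ ⟫ = solve 8 (λ a b c d a′ b′ c′ d′ →
    let x = ⟪ a , b , c , d ⟫; y = ⟪ a′ , b′ , c′ , d′ ⟫ in
    P.norm (x P.⊙ y) := P.norm x :* P.norm y) refl a b c d a′ b′ c′ d′

  norm-• : ∀ k x → norm (k • x) ≡ k * k * norm x
  norm-• k ⟪ a , b , c , d ⟫ = solve 5 (λ k a b c d →
    let x = ⟪ a , b , c , d ⟫ in
    P.norm (k P.• x) := k :* k :* P.norm x) refl k a b c d

  private
    -- The weights 1 + 1/8 and 1 + 8 of Young's inequality |x + y|² ≤ (1 + ε)|x|² + (1 + 1/ε)|y|².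
    -- With ε = 1/8 both 2 · 9/8 < 5/2 and 5/2 · 9/8 < 3.
    9/8 9ℚ : ℚ
    9/8 = + 9 ℚ./ 8
    9ℚ = + 9 ℚ./ 1

  -- The gap is |x − 8y|²/8.
  norm-⊕-≤ : ∀ x y → norm (x ⊕ y) ≤ 9/8 * norm x + 9ℚ * norm y
  norm-⊕-≤ x@(⟪ a , b , c , d ⟫) y@(⟪ a′ , b′ , c′ , d′ ⟫) = 0≤j-i⇒i≤j (subst (0ℚ ≤_)
    (solve 8 (λ a b c d a′ b′ c′ d′ →
      let x = ⟪ a , b , c , d ⟫; y = ⟪ a′ , b′ , c′ , d′ ⟫ in
      con (+ 1 ℚ./ 8) :* P.norm (x P.⊖ con (+ 8 ℚ./ 1) P.• y)
        := con 9/8 :* P.norm x :+ con 9ℚ :* P.norm y :- P.norm (x P.⊕ y)) refl a b c d a′ b′ c′ d′)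
    (*-nonNeg (ℚₚ.<⇒≤ (toWitness {a? = 0ℚ ℚₚ.<? + 1 ℚ./ 8} _)) (norm-nonNeg (x ⊖ (+ 8 ℚ./ 1) • y))))

-- Approximation of rational quaternions and the error budget

module RationalApproximation where
  open import Data.Rational.Base using (_+_; _*_; -_; _-_; _≤_; _<_)
  open ℚSolver
  open Embedding
  open RationalForms
  open Reduction using (dbl; hnorm; norm-dbl; dirichlet; module Lattice)
  private
    module P {n} = QuatOps {Polynomial n} _:+_ _:*_ :-_
    module Z = IntegerForms
    2ℚ 4ℚ 8ℚ 9ℚ 3ℚ 5/2 9/8 3/16 : ℚ
    2ℚ = + 2 ℚ./ 1
    3ℚ = + 3 ℚ./ 1
    4ℚ = + 4 ℚ./ 1
    8ℚ = + 8 ℚ./ 1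
    9ℚ = + 9 ℚ./ 1
    5/2 = + 5 ℚ./ 2
    9/8 = + 9 ℚ./ 8
    3/16 = + 3 ℚ./ 16

  val : Quat ℤ → Quat ℚ
  val x = ½ • mapQ emb (dbl x)

  private
    emb-*-neg : ∀ i j → emb (ℤ.- (i ℤ.* j)) ≡ - (emb i * emb j)
    emb-*-neg i j = trans (emb-neg (i ℤ.* j)) (cong -_ (emb-* i j))

    emb-sum : ∀ i j k l {p q r s} → emb i ≡ p → emb j ≡ q → emb k ≡ r → emb l ≡ s →
      emb (i ℤ.+ j ℤ.+ k ℤ.+ l) ≡ p + q + r + s
    emb-sum i j k l refl refl refl refl = trans (emb-+ (i ℤ.+ j ℤ.+ k) l)
      (cong (_+ emb l) (trans (emb-+ (i ℤ.+ j) k) (cong (_+ emb k) (emb-+ i j))))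

  emb-norm : ∀ x → emb (Z.norm x) ≡ norm (mapQ emb x)
  emb-norm ⟪ a , b , c , d ⟫ = emb-sum (a ℤ.* a) (b ℤ.* b) (c ℤ.* c) (d ℤ.* d)
    (emb-* a a) (emb-* b b) (emb-* c c) (emb-* d d)

  emb-⊙ : ∀ x y → mapQ emb (x Z.⊙ y) ≡ mapQ emb x ⊙ mapQ emb y
  emb-⊙ ⟪ a , b , c , d ⟫ ⟪ a′ , b′ , c′ , d′ ⟫ = ext
    (emb-sum (a ℤ.* a′) (ℤ.- (b ℤ.* b′)) (ℤ.- (c ℤ.* c′)) (ℤ.- (d ℤ.* d′))
      (emb-* a a′) (emb-*-neg b b′) (emb-*-neg c c′) (emb-*-neg d d′))
    (emb-sum (a ℤ.* b′) (b ℤ.* a′) (c ℤ.* d′) (ℤ.- (d ℤ.* c′))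
      (emb-* a b′) (emb-* b a′) (emb-* c d′) (emb-*-neg d c′))
    (emb-sum (a ℤ.* c′) (ℤ.- (b ℤ.* d′)) (c ℤ.* a′) (d ℤ.* b′)
      (emb-* a c′) (emb-*-neg b d′) (emb-* c a′) (emb-* d b′))
    (emb-sum (a ℤ.* d′) (b ℤ.* c′) (ℤ.- (c ℤ.* b′)) (d ℤ.* a′)
      (emb-* a d′) (emb-* b c′) (emb-*-neg c b′) (emb-* d a′))

  emb-⊖-• : ∀ x k y → mapQ emb (x Z.⊖ k Z.• y) ≡ mapQ emb x ⊖ emb k • mapQ emb y
  emb-⊖-• x k y = ext (law (c₀ x) (c₀ y)) (law (c₁ x) (c₁ y)) (law (c₂ x) (c₂ y)) (law (c₃ x) (c₃ y))
    where
    law : ∀ i j → emb (i ℤ.+ ℤ.- (k ℤ.* j)) ≡ emb i + - (emb k * emb j)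
    law i j = trans (emb-+ i (ℤ.- (k ℤ.* j))) (cong (λ p → emb i + p) (emb-*-neg k j))

  norm-val : ∀ x → norm (val x) ≡ emb (hnorm x)
  norm-val x = begin
    norm (½ • mapQ emb (dbl x))            ≡⟨ norm-• ½ (mapQ emb (dbl x)) ⟩
    ½ * ½ * norm (mapQ emb (dbl x))        ≡⟨ cong (½ * ½ *_) (emb-norm (dbl x)) ⟨
    ½ * ½ * emb (Z.norm (dbl x))           ≡⟨ cong (λ i → ½ * ½ * emb i) (norm-dbl x) ⟩
    ½ * ½ * emb (+ 4 ℤ.* hnorm x)          ≡⟨ cong (½ * ½ *_) (emb-* (+ 4) (hnorm x)) ⟩
    ½ * ½ * (4ℚ * emb (hnorm x))
      ≡⟨ solve 1 (λ h → con ½ :* con ½ :* (con 4ℚ :* h) := h) refl (emb (hnorm x)) ⟩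
    emb (hnorm x)                          ∎
    where open ≡-Reasoning

  common-denominator : ∀ x → ∃[ d ] ∃[ X ] + 0 ℤ.< d × emb d • x ≡ mapQ emb X
  common-denominator ⟪ x₀ , x₁ , x₂ , x₃ ⟫ =
    d₀ ℤ.* d₁ ℤ.* d₂ ℤ.* d₃ ,
    ⟪ n₀ ℤ.* d₁ ℤ.* d₂ ℤ.* d₃ , d₀ ℤ.* n₁ ℤ.* d₂ ℤ.* d₃ , d₀ ℤ.* d₁ ℤ.* n₂ ℤ.* d₃ , d₀ ℤ.* d₁ ℤ.* d₂ ℤ.* n₃ ⟫ ,
    Z.*-pos (Z.*-pos (Z.*-pos (0<↧ x₀) (0<↧ x₁)) (0<↧ x₂)) (0<↧ x₃) ,
    ext
      (trans (cong (_* x₀) (emb-product d₀ d₁ d₂ d₃)) (trans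
        (solve 5 (λ x d₀ d₁ d₂ d₃ → d₀ :* d₁ :* d₂ :* d₃ :* x := d₀ :* x :* d₁ :* d₂ :* d₃)
          refl x₀ (emb d₀) (emb d₁) (emb d₂) (emb d₃))
        (trans (cong (λ n → n * emb d₁ * emb d₂ * emb d₃) (*-↧ x₀)) (sym (emb-product n₀ d₁ d₂ d₃)))))
      (trans (cong (_* x₁) (emb-product d₀ d₁ d₂ d₃)) (trans
        (solve 5 (λ x d₀ d₁ d₂ d₃ → d₀ :* d₁ :* d₂ :* d₃ :* x := d₀ :* (d₁ :* x) :* d₂ :* d₃)
          refl x₁ (emb d₀) (emb d₁) (emb d₂) (emb d₃))
        (trans (cong (λ n → emb d₀ * n * emb d₂ * emb d₃) (*-↧ x₁)) (sym (emb-product d₀ n₁ d₂ d₃)))))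
      (trans (cong (_* x₂) (emb-product d₀ d₁ d₂ d₃)) (trans
        (solve 5 (λ x d₀ d₁ d₂ d₃ → d₀ :* d₁ :* d₂ :* d₃ :* x := d₀ :* d₁ :* (d₂ :* x) :* d₃)
          refl x₂ (emb d₀) (emb d₁) (emb d₂) (emb d₃))
        (trans (cong (λ n → emb d₀ * emb d₁ * n * emb d₃) (*-↧ x₂)) (sym (emb-product d₀ d₁ n₂ d₃)))))
      (trans (cong (_* x₃) (emb-product d₀ d₁ d₂ d₃)) (trans
        (ℚₚ.*-assoc (emb d₀ * emb d₁ * emb d₂) (emb d₃) x₃)
        (trans (cong (emb d₀ * emb d₁ * emb d₂ *_) (*-↧ x₃)) (sym (emb-product d₀ d₁ d₂ n₃)))))
    where
    n₀ = ℚ.↥ x₀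
    n₁ = ℚ.↥ x₁
    n₂ = ℚ.↥ x₂
    n₃ = ℚ.↥ x₃
    d₀ = ℚ.↧ x₀
    d₁ = ℚ.↧ x₁
    d₂ = ℚ.↧ x₂
    d₃ = ℚ.↧ x₃
    0<↧ : ∀ x → + 0 ℤ.< ℚ.↧ x
    0<↧ x = ℤ.+<+ (ℕ.s≤s ℕ.z≤n)
    emb-product : ∀ i j k l → emb (i ℤ.* j ℤ.* k ℤ.* l) ≡ emb i * emb j * emb k * emb l
    emb-product i j k l = trans (emb-* (i ℤ.* j ℤ.* k) l) (cong (_* emb l)
      (trans (emb-* (i ℤ.* j) k) (cong (_* emb k) (emb-* i j))))

  rational-dirichlet : ∀ x N → + 1 ℤ.< N → ∃[ q ] ∃[ p ]
    + 0 ℤ.< hnorm q × hnorm q ℤ.≤ N ℤ.* N × emb (N ℤ.* N) * norm (x ⊙ val q ⊖ val p) ≤ 2ℚ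
  rational-dirichlet x N 1<N =
    let q , p , 0<q , q≤ , r≤ = dirichlet X d N 0<d 1<N in q , p , 0<q , q≤ , bound q p r≤
    where
    d = proj₁ (common-denominator x)
    X = proj₁ (proj₂ (common-denominator x))
    0<d = proj₁ (proj₂ (proj₂ (common-denominator x)))
    dx≡X = proj₂ (proj₂ (proj₂ (common-denominator x)))
    D = emb d
    open Lattice X d using (remainder)
    0<D : 0ℚ < D
    0<D = emb-mono-< 0<d
    0<4DD : 0ℚ < 4ℚ * (D * D)
    0<4DD = *-pos {4ℚ} (toWitness {a? = 0ℚ ℚₚ.<? 4ℚ} _) (*-pos 0<D 0<D)
    scaled : ∀ x q p → norm ((D • x) ⊙ q ⊖ D • p) ≡ 4ℚ * (D * D) * norm (x ⊙ (½ • q) ⊖ ½ • p)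
    scaled ⟪ x₀ , x₁ , x₂ , x₃ ⟫ ⟪ q₀ , q₁ , q₂ , q₃ ⟫ ⟪ p₀ , p₁ , p₂ , p₃ ⟫ = trans
      (cong norm (ext (solve 13 (law c₀) refl D x₀ x₁ x₂ x₃ q₀ q₁ q₂ q₃ p₀ p₁ p₂ p₃)
        (solve 13 (law c₁) refl D x₀ x₁ x₂ x₃ q₀ q₁ q₂ q₃ p₀ p₁ p₂ p₃)
        (solve 13 (law c₂) refl D x₀ x₁ x₂ x₃ q₀ q₁ q₂ q₃ p₀ p₁ p₂ p₃)
        (solve 13 (law c₃) refl D x₀ x₁ x₂ x₃ q₀ q₁ q₂ q₃ p₀ p₁ p₂ p₃)))
      (trans (norm-• (2ℚ * D) z) (cong (_* norm z)
        (solve 1 (λ D → con 2ℚ :* D :* (con 2ℚ :* D) := con 4ℚ :* (D :* D)) refl D)))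
      where
      z = ⟪ x₀ , x₁ , x₂ , x₃ ⟫ ⊙ (½ • ⟪ q₀ , q₁ , q₂ , q₃ ⟫) ⊖ ½ • ⟪ p₀ , p₁ , p₂ , p₃ ⟫
      law : ∀ {n} → (∀ {A} → Quat A → A) → (_ _ _ _ _ _ _ _ _ _ _ _ _ : Polynomial n) → _
      law π D x₀ x₁ x₂ x₃ q₀ q₁ q₂ q₃ p₀ p₁ p₂ p₃ =
        let x = ⟪ x₀ , x₁ , x₂ , x₃ ⟫; q = ⟪ q₀ , q₁ , q₂ , q₃ ⟫; p = ⟪ p₀ , p₁ , p₂ , p₃ ⟫ in
        π ((D P.• x) P.⊙ q P.⊖ D P.• p)
          := π ((con 2ℚ :* D) P.• (x P.⊙ (con ½ P.• q) P.⊖ con ½ P.• p))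
    emb-remainder : ∀ q p → emb (Z.norm (remainder q p)) ≡ 4ℚ * (D * D) * norm (x ⊙ val q ⊖ val p)
    emb-remainder q p = begin
      emb (Z.norm (remainder q p))
        ≡⟨ emb-norm (remainder q p) ⟩
      norm (mapQ emb (X Z.⊙ dbl q Z.⊖ d Z.• dbl p))
        ≡⟨ cong norm (trans (emb-⊖-• (X Z.⊙ dbl q) d (dbl p))
             (cong (_⊖ D • mapQ emb (dbl p)) (emb-⊙ X (dbl q)))) ⟩
      norm (mapQ emb X ⊙ mapQ emb (dbl q) ⊖ D • mapQ emb (dbl p))
        ≡⟨ cong (λ X → norm (X ⊙ mapQ emb (dbl q) ⊖ D • mapQ emb (dbl p))) dx≡X ⟨
      norm ((D • x) ⊙ mapQ emb (dbl q) ⊖ D • mapQ emb (dbl p))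
        ≡⟨ scaled x (mapQ emb (dbl q)) (mapQ emb (dbl p)) ⟩
      4ℚ * (D * D) * norm (x ⊙ val q ⊖ val p) ∎
      where open ≡-Reasoning
    bound : ∀ q p → N ℤ.* N ℤ.* Z.norm (remainder q p) ℤ.≤ + 8 ℤ.* (d ℤ.* d) →
      emb (N ℤ.* N) * norm (x ⊙ val q ⊖ val p) ≤ 2ℚ
    bound q p r≤ = ℚₚ.*-cancelˡ-≤-pos (4ℚ * (D * D)) {{ℚ.positive 0<4DD}} (begin
      4ℚ * (D * D) * (emb (N ℤ.* N) * norm (x ⊙ val q ⊖ val p))
        ≡⟨ solve 3 (λ a n r → a :* (n :* r) := n :* (a :* r)) refl
             (4ℚ * (D * D)) (emb (N ℤ.* N)) (norm (x ⊙ val q ⊖ val p)) ⟩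
      emb (N ℤ.* N) * (4ℚ * (D * D) * norm (x ⊙ val q ⊖ val p))
        ≡⟨ cong (emb (N ℤ.* N) *_) (emb-remainder q p) ⟨
      emb (N ℤ.* N) * emb (Z.norm (remainder q p))
        ≡⟨ emb-* (N ℤ.* N) (Z.norm (remainder q p)) ⟨
      emb (N ℤ.* N ℤ.* Z.norm (remainder q p))
        ≤⟨ emb-mono-≤ r≤ ⟩
      emb (+ 8 ℤ.* (d ℤ.* d))
        ≡⟨ trans (emb-* (+ 8) (d ℤ.* d)) (cong (8ℚ *_) (emb-* d d)) ⟩
      8ℚ * (D * D)
        ≡⟨ solve 1 (λ n → con 8ℚ :* n := con 4ℚ :* n :* con 2ℚ) refl (D * D) ⟩
      4ℚ * (D * D) * 2ℚ ∎)
      where open ℚₚ.≤-Reasoning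

  -- Since yq - p = (xq - p) + (y - x)q, Young's inequality gives 9/8 · 2 = 9/4 for the first term;
  -- the closeness hypothesis bounds the second by 9/36 = 1/4.
  perturb : ∀ x y q p n → 0ℚ ≤ n → norm q ≤ n → + 36 ℚ./ 1 * (n * n * norm (y ⊖ x)) ≤ 1ℚ →
    n * norm (x ⊙ q ⊖ p) ≤ 2ℚ → n * norm (y ⊙ q ⊖ p) ≤ 5/2
  perturb x y q p n 0≤n q≤n close approx = begin
    n * norm (y ⊙ q ⊖ p)
      ≡⟨ cong (λ z → n * norm z) (split x y q p) ⟩
    n * norm ((x ⊙ q ⊖ p) ⊕ (y ⊖ x) ⊙ q)
      ≤⟨ ℚₚ.*-monoˡ-≤-nonNeg n {{ℚ.nonNegative 0≤n}} (norm-⊕-≤ (x ⊙ q ⊖ p) ((y ⊖ x) ⊙ q)) ⟩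
    n * (9/8 * norm (x ⊙ q ⊖ p) + 9ℚ * norm ((y ⊖ x) ⊙ q))
      ≡⟨ cong (λ z → n * (9/8 * norm (x ⊙ q ⊖ p) + 9ℚ * z)) (norm-⊙ (y ⊖ x) q) ⟩
    n * (9/8 * norm (x ⊙ q ⊖ p) + 9ℚ * (e * norm q))
      ≡⟨ solve 4 (λ n a e m → n :* (con 9/8 :* a :+ con 9ℚ :* (e :* m))
           := con 9/8 :* (n :* a) :+ con 9ℚ :* (n :* e :* m)) refl n (norm (x ⊙ q ⊖ p)) e (norm q) ⟩
    9/8 * (n * norm (x ⊙ q ⊖ p)) + 9ℚ * (n * e * norm q)
      ≤⟨ ℚₚ.+-mono-≤ (ℚₚ.*-monoˡ-≤-nonNeg 9/8 approx) (ℚₚ.*-monoˡ-≤-nonNeg 9ℚ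
           (ℚₚ.*-monoˡ-≤-nonNeg (n * e) {{ℚ.nonNegative (*-nonNeg 0≤n (norm-nonNeg (y ⊖ x)))}} q≤n)) ⟩
    9/8 * 2ℚ + 9ℚ * (n * e * n)
      ≡⟨ solve 2 (λ n e → con 9/8 :* con 2ℚ :+ con 9ℚ :* (n :* e :* n)
           := con (+ 9 ℚ./ 4) :+ con (+ 1 ℚ./ 4) :* (con (+ 36 ℚ./ 1) :* (n :* n :* e))) refl n e ⟩
    + 9 ℚ./ 4 + + 1 ℚ./ 4 * (+ 36 ℚ./ 1 * (n * n * e))
      ≤⟨ ℚₚ.+-monoʳ-≤ (+ 9 ℚ./ 4) (ℚₚ.*-monoˡ-≤-nonNeg (+ 1 ℚ./ 4) close) ⟩
    5/2 ∎
    where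
    open ℚₚ.≤-Reasoning
    e = norm (y ⊖ x)
    split : ∀ x y q p → y ⊙ q ⊖ p ≡ (x ⊙ q ⊖ p) ⊕ (y ⊖ x) ⊙ q
    split ⟪ x₀ , x₁ , x₂ , x₃ ⟫ ⟪ y₀ , y₁ , y₂ , y₃ ⟫ ⟪ q₀ , q₁ , q₂ , q₃ ⟫ ⟪ p₀ , p₁ , p₂ , p₃ ⟫ = ext
      (solve 13 (law c₀) refl p₀ x₀ x₁ x₂ x₃ y₀ y₁ y₂ y₃ q₀ q₁ q₂ q₃)
      (solve 13 (law c₁) refl p₁ x₀ x₁ x₂ x₃ y₀ y₁ y₂ y₃ q₀ q₁ q₂ q₃)
      (solve 13 (law c₂) refl p₂ x₀ x₁ x₂ x₃ y₀ y₁ y₂ y₃ q₀ q₁ q₂ q₃)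
      (solve 13 (law c₃) refl p₃ x₀ x₁ x₂ x₃ y₀ y₁ y₂ y₃ q₀ q₁ q₂ q₃)
      where
      law : ∀ {n} → (∀ {A} → Quat A → A) → (_ _ _ _ _ _ _ _ _ _ _ _ _ : Polynomial n) → _
      law π p x₀ x₁ x₂ x₃ y₀ y₁ y₂ y₃ q₀ q₁ q₂ q₃ =
        let x = ⟪ x₀ , x₁ , x₂ , x₃ ⟫; y = ⟪ y₀ , y₁ , y₂ , y₃ ⟫; q = ⟪ q₀ , q₁ , q₂ , q₃ ⟫ in
        π (y P.⊙ q) :- p := (π (x P.⊙ q) :- p) :+ π ((y P.⊖ x) P.⊙ q)

  -- (x − p·q̄t)q = (xq − p) + (1 − |q|²t)p, where t is only close to |q|⁻².
  approx-inverse : ∀ x p q t κ → 0ℚ ≤ κ → κ * norm (x ⊙ q ⊖ p) ≤ 5/2 →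
    9ℚ * (κ * ((1ℚ - norm q * t) * (1ℚ - norm q * t) * norm p)) ≤ 3/16 →
    norm (x ⊖ p ⊙ mapQ (_* t) (conj q)) * (κ * norm q) ≤ 3ℚ
  approx-inverse x p q t κ 0≤κ approx small = begin
    norm z * (κ * norm q)
      ≡⟨ solve 3 (λ z κ m → z :* (κ :* m) := κ :* (z :* m)) refl (norm z) κ (norm q) ⟩
    κ * (norm z * norm q)
      ≡⟨ cong (κ *_) (norm-⊙ z q) ⟨
    κ * norm (z ⊙ q)
      ≡⟨ cong (λ y → κ * norm y) (split x p q) ⟩
    κ * norm ((x ⊙ q ⊖ p) ⊕ (1ℚ - norm q * t) • p)
      ≤⟨ ℚₚ.*-monoˡ-≤-nonNeg κ {{ℚ.nonNegative 0≤κ}} (norm-⊕-≤ (x ⊙ q ⊖ p) ((1ℚ - norm q * t) • p)) ⟩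
    κ * (9/8 * norm (x ⊙ q ⊖ p) + 9ℚ * norm ((1ℚ - norm q * t) • p))
      ≡⟨ cong (λ y → κ * (9/8 * norm (x ⊙ q ⊖ p) + 9ℚ * y)) (norm-• (1ℚ - norm q * t) p) ⟩
    κ * (9/8 * norm (x ⊙ q ⊖ p) + 9ℚ * r)
      ≡⟨ solve 3 (λ κ a r → κ :* (con 9/8 :* a :+ con 9ℚ :* r)
           := con 9/8 :* (κ :* a) :+ con 9ℚ :* (κ :* r)) refl κ (norm (x ⊙ q ⊖ p)) r ⟩
    9/8 * (κ * norm (x ⊙ q ⊖ p)) + 9ℚ * (κ * r)
      -- 9/8 · 5/2 + 3/16 = 3.
      ≤⟨ ℚₚ.+-mono-≤ (ℚₚ.*-monoˡ-≤-nonNeg 9/8 approx) small ⟩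
    3ℚ ∎
    where
    open ℚₚ.≤-Reasoning
    z = x ⊖ p ⊙ mapQ (_* t) (conj q)
    r = (1ℚ - norm q * t) * (1ℚ - norm q * t) * norm p
    split : ∀ x p q → (x ⊖ p ⊙ mapQ (_* t) (conj q)) ⊙ q ≡ (x ⊙ q ⊖ p) ⊕ (1ℚ - norm q * t) • p
    split ⟪ x₀ , x₁ , x₂ , x₃ ⟫ ⟪ p₀ , p₁ , p₂ , p₃ ⟫ ⟪ q₀ , q₁ , q₂ , q₃ ⟫ = ext
      (solve 13 (law c₀) refl t x₀ x₁ x₂ x₃ p₀ p₁ p₂ p₃ q₀ q₁ q₂ q₃)
      (solve 13 (law c₁) refl t x₀ x₁ x₂ x₃ p₀ p₁ p₂ p₃ q₀ q₁ q₂ q₃)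
      (solve 13 (law c₂) refl t x₀ x₁ x₂ x₃ p₀ p₁ p₂ p₃ q₀ q₁ q₂ q₃)
      (solve 13 (law c₃) refl t x₀ x₁ x₂ x₃ p₀ p₁ p₂ p₃ q₀ q₁ q₂ q₃)
      where
      law : ∀ {n} → (∀ {A} → Quat A → A) → (_ _ _ _ _ _ _ _ _ _ _ _ _ : Polynomial n) → _
      law π t x₀ x₁ x₂ x₃ p₀ p₁ p₂ p₃ q₀ q₁ q₂ q₃ =
        let x = ⟪ x₀ , x₁ , x₂ , x₃ ⟫; p = ⟪ p₀ , p₁ , p₂ , p₃ ⟫; q = ⟪ q₀ , q₁ , q₂ , q₃ ⟫ in
        π ((x P.⊖ p P.⊙ mapQ (_:* t) (P.conj q)) P.⊙ q)
          := π ((x P.⊙ q P.⊖ p) P.⊕ (con 1ℚ :- P.norm q :* t) P.• p)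

  -- r approximates √m from below up to δ, and t = r⁻².
  ratio-bound : ∀ m r δ t → ½ ≤ r → 0ℚ ≤ δ → δ ≤ 1ℚ → r * r ≤ m → m ≤ (r + δ) * (r + δ) →
    t * (r * r) ≡ 1ℚ → (1ℚ - m * t) * (1ℚ - m * t) ≤ 8ℚ * δ * (8ℚ * δ)
  ratio-bound m r δ t ½≤r 0≤δ δ≤1 r²≤m m≤ tr²≡1 =
    subst (_≤ 8ℚ * δ * (8ℚ * δ))
      (solve 1 (λ a → (a :- con 1ℚ) :* (a :- con 1ℚ) := (con 1ℚ :- a) :* (con 1ℚ :- a)) refl (m * t))
      (*-mono-≤ 0≤e (ℚₚ.≤-trans 0≤e e≤8δ) e≤8δ e≤8δ)
    where
    0≤r : 0ℚ ≤ r
    0≤r = ℚₚ.≤-trans (toWitness {a? = 0ℚ ℚₚ.≤? ½} _) ½≤r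
    0≤t : 0ℚ ≤ t
    -- t = t · (tr²) = t²r².
    0≤t = subst (0ℚ ≤_) (trans (solve 2 (λ t r → t :* t :* (r :* r) := t :* (t :* (r :* r))) refl t r)
      (trans (cong (t *_) tr²≡1) (ℚₚ.*-identityʳ t)))
      (*-nonNeg (square-nonNeg t) (square-nonNeg r))
    0≤e : 0ℚ ≤ m * t - 1ℚ
    0≤e = subst (0ℚ ≤_)
      (trans (solve 3 (λ m r t → t :* (m :- r :* r) := m :* t :- t :* (r :* r)) refl m r t)
        (cong (λ i → m * t - i) tr²≡1))
      (*-nonNeg 0≤t (i≤j⇒0≤j-i r²≤m))
    -- After multiplication by r² the claim is m - r² ≤ 8δr². As m ≤ (r + δ)², it is enough that 2r
    -- + δ ≤ 8r², which follows from r ≥ 1/2 and δ ≤ 1.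
    e≤8δ : m * t - 1ℚ ≤ 8ℚ * δ
    e≤8δ = 0≤j-i⇒i≤j (subst (0ℚ ≤_)
      (trans (solve 4 (λ m r δ t →
          t :* (((r :+ δ) :* (r :+ δ) :- m)
            :+ δ :* (con 8ℚ :* (r :* (r :- con ½)) :+ con 2ℚ :* (r :- con ½) :+ (con 1ℚ :- δ)))
          := con 8ℚ :* δ :* (t :* (r :* r)) :- (m :* t :- t :* (r :* r))) refl m r δ t)
        (cong₂ (λ i j → i - (m * t - j))
          (trans (cong (8ℚ * δ *_) tr²≡1) (ℚₚ.*-identityʳ (8ℚ * δ))) tr²≡1))
      (*-nonNeg 0≤t (ℚₚ.+-mono-≤ (i≤j⇒0≤j-i m≤) (*-nonNeg 0≤δ (ℚₚ.+-mono-≤ (ℚₚ.+-mono-≤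
        (*-nonNeg {8ℚ} (toWitness {a? = 0ℚ ℚₚ.≤? 8ℚ} _) (*-nonNeg 0≤r (i≤j⇒0≤j-i ½≤r)))
        (*-nonNeg {2ℚ} (toWitness {a? = 0ℚ ℚₚ.≤? 2ℚ} _) (i≤j⇒0≤j-i ½≤r)))
        (i≤j⇒0≤j-i δ≤1))))))

  -- √3 < 15/8 leaves room for ε.
  root-gap : ∀ ρ w y E W ε → 0ℚ < w → w * y ≡ 1ℚ → ρ * ρ ≤ E → E * W ≤ 3ℚ → w * w ≤ W →
    0ℚ ≤ ε → 1ℚ ≤ W → 0ℚ ≤ E → 8ℚ * W * ε ≡ 1ℚ → ρ + ε ≤ 2ℚ * y
  root-gap ρ w y E W ε 0<w wy≡1 ρ²≤E EW≤3 w²≤W 0≤ε 1≤W 0≤E 8Wε≡1 = begin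
    ρ + ε                        ≡⟨ ℚₚ.*-identityʳ (ρ + ε) ⟨
    (ρ + ε) * 1ℚ                 ≡⟨ cong ((ρ + ε) *_) wy≡1 ⟨
    (ρ + ε) * (w * y)            ≡⟨ solve 4 (λ ρ ε w y → (ρ :+ ε) :* (w :* y) := (ρ :* w :+ ε :* w) :* y) refl ρ ε w y ⟩
    (ρ * w + ε * w) * y
      ≤⟨ ℚₚ.*-monoʳ-≤-nonNeg y {{ℚ.nonNegative 0≤y}} (ℚₚ.+-mono-≤ ρw≤ εw≤) ⟩
    (+ 15 ℚ./ 8 + + 1 ℚ./ 8) * y ∎
    where
    open ℚₚ.≤-Reasoning
    0≤W : 0ℚ ≤ W
    0≤W = ℚₚ.≤-trans (toWitness {a? = 0ℚ ℚₚ.≤? 1ℚ} _) 1≤W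
    0≤y : 0ℚ ≤ y
    0≤y = *-cancel-0≤ 0<w (subst (0ℚ ≤_) (sym wy≡1) (toWitness {a? = 0ℚ ℚₚ.≤? 1ℚ} _))
    -- W ≥ 1 gives w² ≤ W ≤ W². Hence 8Wε = 1 bounds εw by 1/8, the part of 2 left over by 15/8.
    w≤W : w ≤ W
    w≤W = square-cancel-≤ 0≤W (ℚₚ.≤-trans w²≤W
      (subst (_≤ W * W) (ℚₚ.*-identityˡ W) (ℚₚ.*-monoʳ-≤-nonNeg W {{ℚ.nonNegative 0≤W}} 1≤W)))
    εw≤ : ε * w ≤ + 1 ℚ./ 8
    εw≤ = ℚₚ.≤-trans (ℚₚ.*-monoˡ-≤-nonNeg ε {{ℚ.nonNegative 0≤ε}} w≤W)
      (ℚₚ.≤-reflexive (trans (solve 2 (λ W ε → ε :* W := con (+ 1 ℚ./ 8) :* (con 8ℚ :* W :* ε)) refl W ε)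
        (cong (+ 1 ℚ./ 8 *_) 8Wε≡1)))
    ρw≤ : ρ * w ≤ + 15 ℚ./ 8
    ρw≤ = square-cancel-≤ (toWitness {a? = 0ℚ ℚₚ.≤? + 15 ℚ./ 8} _) (begin
      ρ * w * (ρ * w)     ≡⟨ solve 2 (λ ρ w → ρ :* w :* (ρ :* w) := ρ :* ρ :* (w :* w)) refl ρ w ⟩
      ρ * ρ * (w * w)     ≤⟨ *-mono-≤ (square-nonNeg ρ) 0≤W ρ²≤E w²≤W ⟩
      E * W               ≤⟨ EW≤3 ⟩
      3ℚ                  ≤⟨ toWitness {a? = 3ℚ ℚₚ.≤? + 15 ℚ./ 8 * (+ 15 ℚ./ 8)} _ ⟩
      + 15 ℚ./ 8 * (+ 15 ℚ./ 8) ∎)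

open import Defs

-- From rational estimates to inequalities of reals

module Reals where
  open Embedding
  open RationalForms hiding (*-pos)
  open RationalForms using () renaming (*-pos to *-posℚ)
  open RationalApproximation
  open Reduction using (hnorm)
  private module Z = IntegerForms

  at : ℍ → ℕ → Quat ℚ
  at ⟨ a , b , c , d ⟩ n = ⟪ seq a n , seq b n , seq c n , seq d n ⟫

  opaque
    unfolding √ recip

    seq-∣∣₂ : ∀ ζ n → seq ∣ ζ ∣₂ n ≡ Sequences.rootℚ (norm (at ζ n)) n
    seq-∣∣₂ ζ n = refl

    -- Definitional once the real operations are unfolded. The reciprocal is taken of the square of
    -- the approximate root `r`, so termwise `inv` is only close to an inverse; `ratio-bound`
    -- measures how close.
    at-error : ∀ ξ P Q 0<Q n → let r = seq ∣ Q ∣₂ n in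
      at (ξ -ₕ P *ₕ inv Q 0<Q) n
        ≡ at ξ n ⊖ at P n ⊙ mapQ (ℚ._* Sequences.recipℚ (r ℚ.* r)) (conj (at Q n))
    at-error ξ P Q 0<Q n = refl

    seq-quotient : ∀ x y z 0<yz n →
      seq (x / (y * z) [ 0<yz ]) n ≡ seq x n ℚ.* Sequences.recipℚ (seq y n ℚ.* seq z n)
    seq-quotient x y z 0<yz n = refl

  parity : ∀ e → ∃[ k ] (e ≡ + 2 ℤ.* k ⊎ e ≡ + 1 ℤ.+ + 2 ℤ.* k)
  parity e = e ℤ./ℕ 2 , go (e ℤ.%ℕ 2) (ℤDivMod.n%ℕd<d e 2) (ℤDivMod.a≡a%ℕn+[a/ℕn]*n e 2)
    where
    k = e ℤ./ℕ 2
    go : ∀ r → r ℕ.< 2 → e ≡ + r ℤ.+ k ℤ.* + 2 → e ≡ + 2 ℤ.* k ⊎ e ≡ + 1 ℤ.+ + 2 ℤ.* k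
    go 0 _ e≡ = inj₁ (trans e≡ (trans (ℤₚ.+-identityˡ _) (ℤₚ.*-comm k (+ 2))))
    go 1 _ e≡ = inj₂ (trans e≡ (cong (λ i → + 1 ℤ.+ i) (ℤₚ.*-comm k (+ 2))))
    go (suc (suc _)) (ℕ.s≤s (ℕ.s≤s ())) _

  -- For e = 2k the summand eω is k(1 + i + j + k); for e = 1 + 2k it is (k + 1/2)(1 + i + j + k),
  -- and `half` supplies the 1/2.
  toHurwitz : Quat ℤ → Hurwitz
  toHurwitz ⟪ e , f , g , h ⟫ with parity e
  ... | k , inj₁ _ = whole k (k ℤ.+ f) (k ℤ.+ g) (k ℤ.+ h)
  ... | k , inj₂ _ = half k (k ℤ.+ f) (k ℤ.+ g) (k ℤ.+ h)

  emb-half-even : ∀ {e} k → e ≡ + 2 ℤ.* k → emb k ≡ ½ ℚ.* emb e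
  emb-half-even k refl = sym (trans (cong (½ ℚ.*_) (emb-* (+ 2) k))
    (let open ℚSolver in solve 1 (λ p → con ½ :* (con (emb (+ 2)) :* p) := p) refl (emb k)))

  emb-half-odd : ∀ {e} k → e ≡ + 1 ℤ.+ + 2 ℤ.* k → emb k ℚ.+ ½ ≡ ½ ℚ.* emb e
  emb-half-odd k refl = sym (trans
    (cong (½ ℚ.*_) (trans (emb-+ (+ 1) (+ 2 ℤ.* k)) (cong (1ℚ ℚ.+_) (emb-* (+ 2) k))))
    (let open ℚSolver in
     solve 1 (λ p → con ½ :* (con 1ℚ :+ con (emb (+ 2)) :* p) := p :+ con ½) refl (emb k)))

  at-toHurwitz : ∀ x n → at (toℍ (toHurwitz x)) n ≡ val x
  at-toHurwitz ⟪ e , f , g , h ⟫ n with parity e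
  ... | k , inj₁ e≡2k = ext (emb-half-even k e≡2k) (shifted f) (shifted g) (shifted h)
    where
    shifted : ∀ f → emb (k ℤ.+ f) ≡ ½ ℚ.* emb (e ℤ.+ + 2 ℤ.* f)
    shifted f = emb-half-even (k ℤ.+ f) (trans (cong (ℤ._+ + 2 ℤ.* f) e≡2k) (sym (ℤₚ.*-distribˡ-+ (+ 2) k f)))
  ... | k , inj₂ e≡2k+1 = ext (trans (seq-+ (fromℤ k) (fromℚ ½) n) (emb-half-odd k e≡2k+1))
      (shifted f) (shifted g) (shifted h)
    where
    shifted : ∀ f → seq (fromℤ (k ℤ.+ f) + fromℚ ½) n ≡ ½ ℚ.* emb (e ℤ.+ + 2 ℤ.* f)
    shifted f = trans (seq-+ (fromℤ (k ℤ.+ f)) (fromℚ ½) n) (emb-half-odd (k ℤ.+ f)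
      (trans (cong (ℤ._+ + 2 ℤ.* f) e≡2k+1) (trans (ℤₚ.+-assoc (+ 1) (+ 2 ℤ.* k) (+ 2 ℤ.* f))
        (cong (λ i → + 1 ℤ.+ i) (sym (ℤₚ.*-distribˡ-+ (+ 2) k f))))))

  seq-∣toHurwitz∣₂ : ∀ q n → seq ∣ toℍ (toHurwitz q) ∣₂ n ≡ Sequences.rootℚ (emb (hnorm q)) n
  seq-∣toHurwitz∣₂ q n = trans (seq-∣∣₂ (toℍ (toHurwitz q)) n)
    (cong (λ m → Sequences.rootℚ m n) (trans (cong norm (at-toHurwitz q n)) (norm-val q)))

  inverse : ∀ {p} → 0ℚ ℚ.< p → ∃[ q ] 0ℚ ℚ.< q × p ℚ.* q ≡ 1ℚ
  inverse {p} 0<p = (ℚ.1/ p) {{ℚ.>-nonZero 0<p}} ,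
    ℚₚ.positive⁻¹ _ {{ℚₚ.1/pos⇒pos p {{ℚ.positive 0<p}}}} , ℚₚ.*-inverseʳ p {{ℚ.>-nonZero 0<p}}

  δ : ℕ → ℚ
  δ = Sequences.1/suc

  0≤δ : ∀ n → 0ℚ ℚ.≤ δ n
  0≤δ n = ℚₚ.<⇒≤ (ℚₚ.positive⁻¹ (δ n))

  emb-suc-*-δ : ∀ n → emb (+ suc n) ℚ.* δ n ≡ 1ℚ
  emb-suc-*-δ n = trans (cong (ℚ._* δ n) (ℚₚ.↥p/↧p≡p (Sequences.ι (suc n)))) (ℚₚ.*-inverseʳ (Sequences.ι (suc n)))

  archimedean : ∀ C → 0ℚ ℚ.≤ C → ∃[ M ] ∀ n → M ℕ.≤ n → C ℚ.* δ n ℚ.≤ 1ℚ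
  -- The denominator of `C` is at least 1, so `C` is at most its numerator.
  archimedean C@record{} 0≤C = ℤ.∣ ℚ.↥ C ∣ , λ n M≤n → subst (C ℚ.* δ n ℚ.≤_) (emb-suc-*-δ n)
    (ℚₚ.*-monoʳ-≤-nonNeg (δ n) {{ℚ.nonNegative (0≤δ n)}} (begin
      C                         ≡⟨ ℚₚ.*-identityˡ C ⟨
      1ℚ ℚ.* C
        ≤⟨ ℚₚ.*-monoʳ-≤-nonNeg C {{ℚ.nonNegative 0≤C}} (emb-mono-≤ {+ 1} {ℚ.↧ C} (ℤ.+≤+ (ℕ.s≤s ℕ.z≤n))) ⟩
      emb (ℚ.↧ C) ℚ.* C         ≡⟨ *-↧ C ⟩
      emb (ℚ.↥ C)               ≤⟨ emb-mono-≤ (≤-∣∣ (ℚ.↥ C)) ⟩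
      emb (+ ℤ.∣ ℚ.↥ C ∣)       ≤⟨ emb-mono-≤ (ℤ.+≤+ (ℕₚ.m≤n⇒m≤1+n M≤n)) ⟩
      emb (+ suc n)             ∎))
    where
    open ℚₚ.≤-Reasoning
    ≤-∣∣ : ∀ i → i ℤ.≤ + ℤ.∣ i ∣
    ≤-∣∣ (+ n)    = ℤₚ.≤-refl
    ≤-∣∣ -[1+ n ] = ℤ.-≤+

  δ≤½ : ∀ n → 1 ℕ.≤ n → δ n ℚ.≤ ½
  δ≤½ n 1≤n = begin
    δ n                              ≡⟨ ℚₚ.*-identityˡ (δ n) ⟨
    ½ ℚ.* emb (+ 2) ℚ.* δ n          ≡⟨ ℚₚ.*-assoc ½ (emb (+ 2)) (δ n) ⟩
    ½ ℚ.* (emb (+ 2) ℚ.* δ n)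
      ≤⟨ ℚₚ.*-monoˡ-≤-nonNeg ½ (ℚₚ.*-monoʳ-≤-nonNeg (δ n) {{ℚ.nonNegative (0≤δ n)}}
           (emb-mono-≤ (ℤ.+≤+ (ℕ.s≤s 1≤n)))) ⟩
    ½ ℚ.* (emb (+ suc n) ℚ.* δ n)    ≡⟨ cong (½ ℚ.*_) (emb-suc-*-δ n) ⟩
    ½ ∎
    where open ℚₚ.≤-Reasoning

  -- Nonzero Hurwitz norms are integers, hence at least 1. This removes the cut-off at 0 in `rootℚ`
  -- and keeps its values away from 0.
  module Root (m : ℚ) (1≤m : 1ℚ ℚ.≤ m) (n : ℕ) where
    r : ℚ
    r = Sequences.rootℚ m n

    private
      m⊔0≡m : m ℚ.⊔ 0ℚ ≡ m
      m⊔0≡m = ℚₚ.p≥q⇒p⊔q≡p (ℚₚ.≤-trans (toWitness {a? = 0ℚ ℚₚ.≤? 1ℚ} _) 1≤m)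

    0≤r : 0ℚ ℚ.≤ r
    0≤r = proj₁ (Sequences.rootℚ-spec m n)

    r²≤m : r ℚ.* r ℚ.≤ m
    r²≤m = subst (r ℚ.* r ℚ.≤_) m⊔0≡m (proj₁ (proj₂ (Sequences.rootℚ-spec m n)))

    m≤[r+δ]² : m ℚ.≤ (r ℚ.+ δ n) ℚ.* (r ℚ.+ δ n)
    m≤[r+δ]² = subst (ℚ._≤ (r ℚ.+ δ n) ℚ.* (r ℚ.+ δ n)) m⊔0≡m
      (ℚₚ.<⇒≤ (proj₂ (proj₂ (Sequences.rootℚ-spec m n))))

    1≤r+δ : 1ℚ ℚ.≤ r ℚ.+ δ n
    1≤r+δ = square-cancel-≤ (ℚₚ.+-mono-≤ 0≤r (0≤δ n)) (ℚₚ.≤-trans 1≤m m≤[r+δ]²)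

    -- Obtained from 1 ≤ r + δ. At index 0, δ is 1 and this only gives r ≥ 0, hence the restriction
    -- on `n`.
    ½≤r : 1 ℕ.≤ n → ½ ℚ.≤ r
    ½≤r 1≤n = 0≤j-i⇒i≤j (subst (0ℚ ℚ.≤_)
      (let open ℚSolver in
       solve 2 (λ r d → (r :+ d :- con 1ℚ) :+ (con ½ :- d) := r :- con ½) refl r (δ n))
      (ℚₚ.+-mono-≤ (i≤j⇒0≤j-i 1≤r+δ) (i≤j⇒0≤j-i (δ≤½ n 1≤n))))

  1≤emb : ∀ {i} → + 0 ℤ.< i → 1ℚ ℚ.≤ emb i
  1≤emb 0<i = emb-mono-≤ (ℤₚ.i<j⇒suc[i]≤j 0<i)

  -- An approximate root may fall short of 1, but by at most δ, which tends to 0.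
  1≤∣toHurwitz∣₂ : ∀ q → + 0 ℤ.< hnorm q → 1ℝ ≤ ∣ toℍ (toHurwitz q) ∣₂
  1≤∣toHurwitz∣₂ q 0<q = *≤* λ ε 0<ε →
    let C , 0<C , εC≡1 = inverse 0<ε
        M , small      = archimedean C (ℚₚ.<⇒≤ 0<C)
    in M , λ n M≤n → begin
      1ℚ                                  ≤⟨ Root.1≤r+δ (emb (hnorm q)) (1≤emb 0<q) n ⟩
      root n ℚ.+ δ n                      ≤⟨ ℚₚ.+-monoʳ-≤ (root n) (δ≤ ε C (δ n) (ℚₚ.<⇒≤ 0<ε) εC≡1 (small n M≤n)) ⟩
      root n ℚ.+ ε                        ≡⟨ cong (ℚ._+ ε) (seq-∣toHurwitz∣₂ q n) ⟨
      seq ∣ toℍ (toHurwitz q) ∣₂ n ℚ.+ ε  ∎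
    where
    open ℚₚ.≤-Reasoning
    root : ℕ → ℚ
    root = Sequences.rootℚ (emb (hnorm q))
    δ≤ : ∀ ε C d → 0ℚ ℚ.≤ ε → ε ℚ.* C ≡ 1ℚ → C ℚ.* d ℚ.≤ 1ℚ → d ℚ.≤ ε
    δ≤ ε C d 0≤ε εC≡1 Cd≤1 = subst₂ ℚ._≤_
      (trans (sym (ℚₚ.*-assoc ε C d)) (trans (cong (ℚ._* d) εC≡1) (ℚₚ.*-identityˡ d)))
      (ℚₚ.*-identityʳ ε) (ℚₚ.*-monoˡ-≤-nonNeg ε {{ℚ.nonNegative 0≤ε}} Cd≤1)

  -- Approximate roots never exceed the true root, so the bound holds from index 0 on.
  ∣toHurwitz∣₂≤ : ∀ q N → + 0 ℤ.< hnorm q → + 0 ℤ.≤ N → hnorm q ℤ.≤ N ℤ.* N →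
    ∣ toℍ (toHurwitz q) ∣₂ ≤ fromℤ N
  ∣toHurwitz∣₂≤ q N 0<q 0≤N q≤N² = *≤* λ ε 0<ε → 0 , λ n _ → begin
    seq ∣ toℍ (toHurwitz q) ∣₂ n      ≡⟨ seq-∣toHurwitz∣₂ q n ⟩
    Sequences.rootℚ (emb (hnorm q)) n
      ≤⟨ square-cancel-≤ (emb-mono-≤ 0≤N) (ℚₚ.≤-trans (Root.r²≤m (emb (hnorm q)) (1≤emb 0<q) n)
           (subst (emb (hnorm q) ℚ.≤_) (emb-* N N) (emb-mono-≤ q≤N²))) ⟩
    emb N                             ≡⟨ ℚₚ.+-identityʳ (emb N) ⟨
    emb N ℚ.+ 0ℚ                      ≤⟨ ℚₚ.+-monoʳ-≤ (emb N) (ℚₚ.<⇒≤ 0<ε) ⟩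
    emb N ℚ.+ ε                       ∎
    where open ℚₚ.≤-Reasoning

  -- Late terms satisfy κ|ξq - p|² ≤ 5/2, a condition on rationals only. `κ` is N² in the finite
  -- bound and |q|² in the infinite family.
  Approximates : ℍ → ℚ → Quat ℤ → Quat ℤ → Set
  Approximates ξ κ q p = ∃[ M ] ∀ n → M ℕ.≤ n →
    κ ℚ.* norm (at ξ n ⊙ val q ⊖ val p) ℚ.≤ + 5 ℚ./ 2

  -- Here `k` is the second factor of the denominator, N or |q|, with k² ≤ κ termwise. The squared
  -- error E satisfies E·κ|q|² ≤ 3, and `root-gap` turns this into a uniform gap below 2/(|q|k).
  approximates⇒< : ∀ ξ q p κ k → + 0 ℤ.< hnorm q → 1ℚ ℚ.≤ κ →
    (∀ n → 1 ℕ.≤ n → 0ℚ ℚ.< seq k n × seq k n ℚ.* seq k n ℚ.≤ κ) →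
    Approximates ξ κ q p → ∀ 0<Q 0<Qk → let Q = toℍ (toHurwitz q) in
    ∣ ξ -ₕ toℍ (toHurwitz p) *ₕ inv Q 0<Q ∣₂ < 2ℝ / (∣ Q ∣₂ * k) [ 0<Qk ]
  approximates⇒< ξ q p κ k 0<q 1≤κ k-bounds (M , approx) 0<Q 0<Qk =
    *<* (ε , 0<ε , M ℕ.⊔ (M′ ℕ.⊔ 1) , λ n hn →
      bound n (ℕₚ.m⊔n≤o⇒m≤o M (M′ ℕ.⊔ 1) hn)
        (ℕₚ.m⊔n≤o⇒m≤o M′ 1 (ℕₚ.m⊔n≤o⇒n≤o M (M′ ℕ.⊔ 1) hn))
        (ℕₚ.m⊔n≤o⇒n≤o M′ 1 (ℕₚ.m⊔n≤o⇒n≤o M (M′ ℕ.⊔ 1) hn)))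
    where
    P = toℍ (toHurwitz p)
    Q = toℍ (toHurwitz q)
    m = emb (hnorm q)
    W = κ ℚ.* m
    C = κ ℚ.* norm (val p)
    0≤1 : 0ℚ ℚ.≤ 1ℚ
    0≤1 = toWitness {a? = 0ℚ ℚₚ.≤? 1ℚ} _
    0<1 : 0ℚ ℚ.< 1ℚ
    0<1 = toWitness {a? = 0ℚ ℚₚ.<? 1ℚ} _
    1≤m : 1ℚ ℚ.≤ m
    1≤m = 1≤emb 0<q
    0≤κ : 0ℚ ℚ.≤ κ
    0≤κ = ℚₚ.≤-trans 0≤1 1≤κ
    0≤C : 0ℚ ℚ.≤ C
    0≤C = *-nonNeg 0≤κ (norm-nonNeg (val p))
    1≤W : 1ℚ ℚ.≤ W
    1≤W = *-mono-≤ 0≤1 (ℚₚ.≤-trans 0≤1 1≤m) 1≤κ 1≤m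
    8ℚ = + 8 ℚ./ 1
    -- ε = 1/(8κ|q|²) is independent of the index, as strict inequality of reals requires.
    ε∃ = inverse (*-posℚ {8ℚ} (toWitness {a? = 0ℚ ℚₚ.<? 8ℚ} _) (ℚₚ.<-≤-trans 0<1 1≤W))
    ε = proj₁ ε∃
    0<ε = proj₁ (proj₂ ε∃)
    8Wε≡1 = proj₂ (proj₂ ε∃)
    -- 9 · 8² = 3/16 · 3072. So C′δ ≤ 1 and δ ≤ 1 keep the contribution of the approximate inverse
    -- within 3/16.
    L = + 3072 ℚ./ 1
    C′ = L ℚ.* C
    M′∃ = archimedean C′ (*-nonNeg {L} (toWitness {a? = 0ℚ ℚₚ.≤? L} _) 0≤C)
    M′ = proj₁ M′∃
    bound : ∀ n → M ℕ.≤ n → M′ ℕ.≤ n → 1 ℕ.≤ n →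
      seq ∣ ξ -ₕ P *ₕ inv Q 0<Q ∣₂ n ℚ.+ ε ℚ.≤ seq (2ℝ / (∣ Q ∣₂ * k) [ 0<Qk ]) n
    bound n M≤n M′≤n 1≤n = subst₂ (λ i j → i ℚ.+ ε ℚ.≤ j)
      (sym (trans (seq-∣∣₂ (ξ -ₕ P *ₕ inv Q 0<Q) n) (cong (λ x → Sequences.rootℚ (norm x) n) at-z)))
      (sym (trans (seq-quotient 2ℝ ∣ Q ∣₂ k 0<Qk n)
        (cong (λ i → emb (+ 2) ℚ.* Sequences.recipℚ (i ℚ.* seq k n)) (seq-∣toHurwitz∣₂ q n))))
      (root-gap (Sequences.rootℚ E n) w (Sequences.recipℚ w) E W ε 0<w
        (Sequences.recipℚ-inverse w (λ w≡0 → ℚₚ.<⇒≢ 0<w (sym w≡0)))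
        ρ²≤E EW≤3 w²≤W (ℚₚ.<⇒≤ 0<ε) 1≤W (norm-nonNeg z) 8Wε≡1)
      where
      open Root m 1≤m n
      t = Sequences.recipℚ (r ℚ.* r)
      z = at ξ n ⊖ val p ⊙ mapQ (ℚ._* t) (conj (val q))
      E = norm z
      w = r ℚ.* seq k n
      at-z : at (ξ -ₕ P *ₕ inv Q 0<Q) n ≡ z
      at-z = trans (at-error ξ P Q 0<Q n)
        (trans (cong₂ (λ x y → at ξ n ⊖ x ⊙ mapQ (ℚ._* Sequences.recipℚ (y ℚ.* y)) (conj (at Q n)))
          (at-toHurwitz p n) (seq-∣toHurwitz∣₂ q n))
          (cong (λ x → at ξ n ⊖ val p ⊙ mapQ (ℚ._* t) (conj x)) (at-toHurwitz q n)))
      0<r : 0ℚ ℚ.< r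
      0<r = ℚₚ.<-≤-trans (toWitness {a? = 0ℚ ℚₚ.<? ½} _) (½≤r 1≤n)
      0<w : 0ℚ ℚ.< w
      0<w = *-posℚ 0<r (proj₁ (k-bounds n 1≤n))
      w²≤W : w ℚ.* w ℚ.≤ W
      w²≤W = subst (ℚ._≤ W)
        (let open ℚSolver in solve 2 (λ r k → (k :* k) :* (r :* r) := (r :* k) :* (r :* k)) refl r (seq k n))
        (*-mono-≤ (square-nonNeg (seq k n)) (ℚₚ.≤-trans 0≤1 1≤m) (proj₂ (k-bounds n 1≤n)) r²≤m)
      ρ²≤E : Sequences.rootℚ E n ℚ.* Sequences.rootℚ E n ℚ.≤ E
      ρ²≤E = subst (Sequences.rootℚ E n ℚ.* Sequences.rootℚ E n ℚ.≤_)
        (ℚₚ.p≥q⇒p⊔q≡p (norm-nonNeg z)) (proj₁ (proj₂ (Sequences.rootℚ-spec E n)))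
      0<r² = *-posℚ 0<r 0<r
      tr²≡1 : t ℚ.* (r ℚ.* r) ≡ 1ℚ
      tr²≡1 = trans (ℚₚ.*-comm t (r ℚ.* r))
        (Sequences.recipℚ-inverse (r ℚ.* r) (λ r²≡0 → ℚₚ.<⇒≢ 0<r² (sym r²≡0)))
      δ≤1 : δ n ℚ.≤ 1ℚ
      δ≤1 = ℚₚ.≤-trans (δ≤½ n 1≤n) (toWitness {a? = ½ ℚₚ.≤? 1ℚ} _)
      e = 1ℚ ℚ.- m ℚ.* t
      9ℚ = + 9 ℚ./ 1
      3/16 = + 3 ℚ./ 16
      small : 9ℚ ℚ.* (κ ℚ.* (e ℚ.* e ℚ.* norm (val p))) ℚ.≤ 3/16
      small = begin
        9ℚ ℚ.* (κ ℚ.* (e ℚ.* e ℚ.* norm (val p)))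
          ≡⟨ (let open ℚSolver in solve 3 (λ κ e p → con 9ℚ :* (κ :* (e :* p))
               := con 9ℚ :* ((κ :* p) :* e)) refl κ (e ℚ.* e) (norm (val p))) ⟩
        9ℚ ℚ.* (C ℚ.* (e ℚ.* e))
          ≤⟨ ℚₚ.*-monoˡ-≤-nonNeg 9ℚ (ℚₚ.*-monoˡ-≤-nonNeg C {{ℚ.nonNegative 0≤C}}
               (ratio-bound m r (δ n) t (½≤r 1≤n) (0≤δ n) δ≤1 r²≤m m≤[r+δ]² tr²≡1)) ⟩
        9ℚ ℚ.* (C ℚ.* (8ℚ ℚ.* δ n ℚ.* (8ℚ ℚ.* δ n)))
          ≡⟨ (let open ℚSolver in solve 2 (λ C d → con 9ℚ :* (C :* (con 8ℚ :* d :* (con 8ℚ :* d)))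
               := con 3/16 :* ((con L :* C :* d) :* d)) refl C (δ n)) ⟩
        3/16 ℚ.* ((C′ ℚ.* δ n) ℚ.* δ n)
          ≤⟨ ℚₚ.*-monoˡ-≤-nonNeg 3/16 (*-mono-≤ {C′ ℚ.* δ n} {1ℚ} (*-nonNeg (*-nonNeg {L}
               (toWitness {a? = 0ℚ ℚₚ.≤? L} _) 0≤C) (0≤δ n)) 0≤1 (proj₂ M′∃ n M′≤n) δ≤1) ⟩
        3/16 ∎
        where open ℚₚ.≤-Reasoning
      EW≤3 : E ℚ.* W ℚ.≤ + 3 ℚ./ 1
      EW≤3 = subst (λ i → E ℚ.* (κ ℚ.* i) ℚ.≤ + 3 ℚ./ 1) (norm-val q)
        (approx-inverse (at ξ n) (val p) (val q) t κ 0≤κ (approx n M≤n)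
          (subst (λ i → 9ℚ ℚ.* (κ ℚ.* ((1ℚ ℚ.- i ℚ.* t) ℚ.* (1ℚ ℚ.- i ℚ.* t) ℚ.* norm (val p))) ℚ.≤ 3/16)
            (sym (norm-val q)) small))

  ∣toHurwitz∣₂-bounds : ∀ q → + 0 ℤ.< hnorm q → ∀ n → 1 ℕ.≤ n → let r = seq ∣ toℍ (toHurwitz q) ∣₂ n in
    0ℚ ℚ.< r × r ℚ.* r ℚ.≤ emb (hnorm q)
  ∣toHurwitz∣₂-bounds q 0<q n 1≤n = subst (λ r → 0ℚ ℚ.< r × r ℚ.* r ℚ.≤ emb (hnorm q))
    (sym (seq-∣toHurwitz∣₂ q n))
    (ℚₚ.<-≤-trans (toWitness {a? = 0ℚ ℚₚ.<? ½} _) (½≤r 1≤n) , r²≤m)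
    where open Root (emb (hnorm q)) (1≤emb 0<q) n

  cauchyQ : ∀ ξ η → 0ℚ ℚ.< η → ∃[ M ] ∀ n → M ℕ.≤ n →
    norm (at ξ n ⊖ at ξ M) ℚ.≤ + 4 ℚ./ 1 ℚ.* (η ℚ.* η)
  cauchyQ ⟨ a , b , c , d ⟩ η 0<η =
    let Ma , ha = cauchy a η 0<η
        Mb , hb = cauchy b η 0<η
        Mc , hc = cauchy c η 0<η
        Md , hd = cauchy d η 0<η
        M = (Ma ℕ.⊔ Mb) ℕ.⊔ (Mc ℕ.⊔ Md)
        Ma≤M = ℕₚ.≤-trans (ℕₚ.m≤m⊔n Ma Mb) (ℕₚ.m≤m⊔n (Ma ℕ.⊔ Mb) (Mc ℕ.⊔ Md))
        Mb≤M = ℕₚ.≤-trans (ℕₚ.m≤n⊔m Ma Mb) (ℕₚ.m≤m⊔n (Ma ℕ.⊔ Mb) (Mc ℕ.⊔ Md))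
        Mc≤M = ℕₚ.≤-trans (ℕₚ.m≤m⊔n Mc Md) (ℕₚ.m≤n⊔m (Ma ℕ.⊔ Mb) (Mc ℕ.⊔ Md))
        Md≤M = ℕₚ.≤-trans (ℕₚ.m≤n⊔m Mc Md) (ℕₚ.m≤n⊔m (Ma ℕ.⊔ Mb) (Mc ℕ.⊔ Md))
    in M , λ n M≤n → ℚₚ.≤-trans
      (ℚₚ.+-mono-≤ (ℚₚ.+-mono-≤ (ℚₚ.+-mono-≤
        (square (ha n M (ℕₚ.≤-trans Ma≤M M≤n) Ma≤M)) (square (hb n M (ℕₚ.≤-trans Mb≤M M≤n) Mb≤M)))
        (square (hc n M (ℕₚ.≤-trans Mc≤M M≤n) Mc≤M))) (square (hd n M (ℕₚ.≤-trans Md≤M M≤n) Md≤M)))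
      (ℚₚ.≤-reflexive (let open ℚSolver in
        solve 1 (λ s → s :+ s :+ s :+ s := con (+ 4 ℚ./ 1) :* s) refl (η ℚ.* η)))
    where
    square : ∀ {p} → ℚ.∣ p ∣ ℚ.< η → p ℚ.* p ℚ.≤ η ℚ.* η
    square {p} ∣p∣<η = subst (ℚ._≤ η ℚ.* η)
      (trans (sym (ℚₚ.∣p*q∣≡∣p∣*∣q∣ p p)) (ℚₚ.0≤p⇒∣p∣≡p (square-nonNeg p)))
      (*-mono-≤ (ℚₚ.0≤∣p∣ p) (ℚₚ.<⇒≤ 0<η) (ℚₚ.<⇒≤ ∣p∣<η) (ℚₚ.<⇒≤ ∣p∣<η))

  -- The precision has to be fixed before q is known. The bound |q| ≤ N, available in advance, makes
  -- this possible.
  approximate : ∀ ξ N → + 1 ℤ.< N → ∃[ q ] ∃[ p ]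
    + 0 ℤ.< hnorm q × hnorm q ℤ.≤ N ℤ.* N × Approximates ξ (emb (N ℤ.* N)) q p
  approximate ξ N 1<N =
    -- With 12nη = 1 the bound 36n² · 4η² is (12nη)² = 1, as `perturb` asks.
    let η , 0<η , 12nη≡1     = inverse (*-posℚ {12ℚ} (toWitness {a? = 0ℚ ℚₚ.<? 12ℚ} _) 0<n)
        M , close            = cauchyQ ξ η 0<η
        q , p , 0<q , q≤ , h = rational-dirichlet (at ξ M) N 1<N
    in q , p , 0<q , q≤ , M , λ k M≤k →
      perturb (at ξ M) (at ξ k) (val q) (val p) n (ℚₚ.<⇒≤ 0<n)
        (subst (ℚ._≤ n) (sym (norm-val q)) (emb-mono-≤ q≤))
        (subst (36ℚ ℚ.* (n ℚ.* n ℚ.* norm (at ξ k ⊖ at ξ M)) ℚ.≤_)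
          (trans (let open ℚSolver in solve 2 (λ n η → con 36ℚ :* (n :* n :* (con (+ 4 ℚ./ 1) :* (η :* η)))
              := (con 12ℚ :* n :* η) :* (con 12ℚ :* n :* η)) refl n η)
            (cong (λ i → i ℚ.* i) 12nη≡1))
          (ℚₚ.*-monoˡ-≤-nonNeg 36ℚ
            (ℚₚ.*-monoˡ-≤-nonNeg (n ℚ.* n) {{ℚ.nonNegative (square-nonNeg n)}} (close k M≤k))))
        h
    where
    12ℚ = + 12 ℚ./ 1
    36ℚ = + 36 ℚ./ 1
    n = emb (N ℤ.* N)
    0<N = ℤₚ.<-trans (ℤ.+<+ (ℕ.s≤s ℕ.z≤n)) 1<N
    0<n : 0ℚ ℚ.< n
    0<n = emb-mono-< (IntegerForms.*-pos 0<N 0<N)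

  -- Infinitely many pairs

  hnorm-• : ∀ s q → hnorm (s Z.• q) ≡ s ℤ.* s ℤ.* hnorm q
  hnorm-• s ⟪ e , f , g , h ⟫ = let open ℤSolver in solve 5 (λ s e f g h →
    let sq = λ e f g h → e :* e :+ e :* f :+ e :* g :+ e :* h :+ f :* f :+ g :* g :+ h :* h in
    sq (s :* e) (s :* f) (s :* g) (s :* h) := s :* s :* sq e f g h) refl s e f g h

  norm-error-• : ∀ x s q p →
    norm (x ⊙ val (s Z.• q) ⊖ val (s Z.• p)) ≡ emb s ℚ.* emb s ℚ.* norm (x ⊙ val q ⊖ val p)
  norm-error-• x s q p = trans (cong₂ (λ q p → norm (x ⊙ q ⊖ p)) (val-• q) (val-• p))
    (trans (cong norm (factor x (val q) (val p))) (norm-• (emb s) (x ⊙ val q ⊖ val p)))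
    where
    val-• : ∀ q → val (s Z.• q) ≡ emb s • val q
    val-• ⟪ e , f , g , h ⟫ = ext
      (trans (cong (½ ℚ.*_) (emb-* s e)) (swap (emb e)))
      (law f) (law g) (law h)
      where
      swap : ∀ e → ½ ℚ.* (emb s ℚ.* e) ≡ emb s ℚ.* (½ ℚ.* e)
      swap = let open ℚSolver in solve 2 (λ s e → con ½ :* (s :* e) := s :* (con ½ :* e)) refl (emb s)
      law : ∀ f → ½ ℚ.* emb (s ℤ.* e ℤ.+ + 2 ℤ.* (s ℤ.* f)) ≡ emb s ℚ.* (½ ℚ.* emb (e ℤ.+ + 2 ℤ.* f))
      law f = trans (cong (½ ℚ.*_) (trans
        (cong emb (let open ℤSolver in solve 3 (λ s e f →
          s :* e :+ con (+ 2) :* (s :* f) := s :* (e :+ con (+ 2) :* f)) refl s e f))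
        (emb-* s (e ℤ.+ + 2 ℤ.* f)))) (swap (emb (e ℤ.+ + 2 ℤ.* f)))
    factor : ∀ x q p → x ⊙ (emb s • q) ⊖ emb s • p ≡ emb s • (x ⊙ q ⊖ p)
    factor ⟪ x₀ , x₁ , x₂ , x₃ ⟫ ⟪ q₀ , q₁ , q₂ , q₃ ⟫ ⟪ p₀ , p₁ , p₂ , p₃ ⟫ = ext
      (solve 10 (law c₀) refl (emb s) p₀ x₀ x₁ x₂ x₃ q₀ q₁ q₂ q₃)
      (solve 10 (law c₁) refl (emb s) p₁ x₀ x₁ x₂ x₃ q₀ q₁ q₂ q₃)
      (solve 10 (law c₂) refl (emb s) p₂ x₀ x₁ x₂ x₃ q₀ q₁ q₂ q₃)
      (solve 10 (law c₃) refl (emb s) p₃ x₀ x₁ x₂ x₃ q₀ q₁ q₂ q₃)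
      where
      open ℚSolver
      module P {n} = QuatOps {Polynomial n} _:+_ _:*_ :-_
      law : ∀ {n} → (∀ {A} → Quat A → A) → (_ _ _ _ _ _ _ _ _ _ : Polynomial n) → _
      law π s p x₀ x₁ x₂ x₃ q₀ q₁ q₂ q₃ =
        let x = ⟪ x₀ , x₁ , x₂ , x₃ ⟫; q = ⟪ q₀ , q₁ , q₂ , q₃ ⟫ in
        π (x P.⊙ (s P.• q)) :- s :* p := s :* (π (x P.⊙ q) :- p)

  Approximates-mono : ∀ ξ {κ κ′} q p → κ′ ℚ.≤ κ → Approximates ξ κ q p → Approximates ξ κ′ q p
  Approximates-mono ξ q p κ′≤κ (M , h) = M , λ n M≤n → ℚₚ.≤-trans
    (ℚₚ.*-monoʳ-≤-nonNeg (norm (at ξ n ⊙ val q ⊖ val p))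
      {{ℚ.nonNegative (norm-nonNeg (at ξ n ⊙ val q ⊖ val p))}} κ′≤κ) (h n M≤n)

  Good : ℍ → Quat ℤ × Quat ℤ → Set
  Good ξ (q , p) = + 0 ℤ.< hnorm q × Approximates ξ (emb (hnorm q)) q p

  -- Scaling by s multiplies |ξq - p|² by s², and the hypothesis |sq|²s² ≤ N² absorbs that factor.
  Approximates-• : ∀ ξ s {N} q p → hnorm (s Z.• q) ℤ.* (s ℤ.* s) ℤ.≤ N ℤ.* N →
    Approximates ξ (emb (N ℤ.* N)) q p → Approximates ξ (emb (hnorm (s Z.• q))) (s Z.• q) (s Z.• p)
  Approximates-• ξ s {N} q p s⁴m≤N² (M , h) = M , λ n M≤n → begin
    emb M′ ℚ.* norm (at ξ n ⊙ val (s Z.• q) ⊖ val (s Z.• p))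
      ≡⟨ cong (emb M′ ℚ.*_) (norm-error-• (at ξ n) s q p) ⟩
    emb M′ ℚ.* (emb s ℚ.* emb s ℚ.* err n)
      ≡⟨ ℚₚ.*-assoc (emb M′) (emb s ℚ.* emb s) (err n) ⟨
    emb M′ ℚ.* (emb s ℚ.* emb s) ℚ.* err n
      ≡⟨ cong (ℚ._* err n) (trans (emb-* M′ (s ℤ.* s)) (cong (emb M′ ℚ.*_) (emb-* s s))) ⟨
    emb (M′ ℤ.* (s ℤ.* s)) ℚ.* err n
      ≤⟨ proj₂ (Approximates-mono ξ q p (emb-mono-≤ s⁴m≤N²) (M , h)) n M≤n ⟩
    + 5 ℚ./ 2 ∎
    where
    open ℚₚ.≤-Reasoning
    M′ = hnorm (s Z.• q)
    err : ℕ → ℚ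
    err n = norm (at ξ n ⊙ val q ⊖ val p)

  -- The case split compares integers. In the second case |q|² ≤ K < s ≤ s², so s⁴|q|² ≤ s⁶, which
  -- is N² because N = s³; and |sq|² ≥ s > K.
  next-from : ∀ ξ s K q p → + 1 ℤ.< s → K ℤ.< s → + 0 ℤ.< hnorm q →
    let N = s ℤ.* s ℤ.* s in hnorm q ℤ.≤ N ℤ.* N → Approximates ξ (emb (N ℤ.* N)) q p →
    ∃[ qp ] K ℤ.< hnorm (proj₁ qp) × Good ξ qp
  next-from ξ s K q p 1<s K<s 0<q q≤ h with K ℤ.<? hnorm q
  ... | yes K<q = (q , p) , K<q , 0<q , Approximates-mono ξ q p (emb-mono-≤ q≤) h
  ... | no  K≮q = (s Z.• q , s Z.• p) , ℤₚ.<-≤-trans K<s s≤sq , ℤₚ.<-≤-trans 0<s s≤sq ,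
                  Approximates-• ξ s {N} q p s⁴m≤N² h
    where
    open ℤₚ.≤-Reasoning
    N = s ℤ.* s ℤ.* s
    m = hnorm q
    0<s : + 0 ℤ.< s
    0<s = ℤₚ.<-trans (ℤ.+<+ (ℕ.s≤s ℕ.z≤n)) 1<s
    instance
      s-nonNeg : ℤ.NonNegative s
      s-nonNeg = ℤ.nonNegative (ℤₚ.<⇒≤ 0<s)
      s²-nonNeg : ℤ.NonNegative (s ℤ.* s)
      s²-nonNeg = ℤ.nonNegative (ℤₚ.<⇒≤ (IntegerForms.*-pos 0<s 0<s))
    s≤s² : s ℤ.≤ s ℤ.* s
    s≤s² = subst (ℤ._≤ s ℤ.* s) (ℤₚ.*-identityʳ s) (ℤₚ.*-monoˡ-≤-nonNeg s (ℤₚ.<⇒≤ 1<s))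
    m≤s² : m ℤ.≤ s ℤ.* s
    m≤s² = ℤₚ.≤-trans (ℤₚ.≮⇒≥ K≮q) (ℤₚ.≤-trans (ℤₚ.<⇒≤ K<s) s≤s²)
    s≤sq : s ℤ.≤ hnorm (s Z.• q)
    s≤sq = begin
      s                    ≤⟨ s≤s² ⟩
      s ℤ.* s              ≡⟨ ℤₚ.*-identityʳ (s ℤ.* s) ⟨
      s ℤ.* s ℤ.* + 1      ≤⟨ ℤₚ.*-monoˡ-≤-nonNeg (s ℤ.* s) (ℤₚ.i<j⇒suc[i]≤j 0<q) ⟩
      s ℤ.* s ℤ.* m        ≡⟨ hnorm-• s q ⟨
      hnorm (s Z.• q)      ∎
    s⁴m≤N² : hnorm (s Z.• q) ℤ.* (s ℤ.* s) ℤ.≤ N ℤ.* N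
    s⁴m≤N² = begin
      hnorm (s Z.• q) ℤ.* (s ℤ.* s)
        ≡⟨ cong (ℤ._* (s ℤ.* s)) (hnorm-• s q) ⟩
      s ℤ.* s ℤ.* m ℤ.* (s ℤ.* s)
        ≤⟨ ℤₚ.*-monoʳ-≤-nonNeg (s ℤ.* s) (ℤₚ.*-monoˡ-≤-nonNeg (s ℤ.* s) m≤s²) ⟩
      s ℤ.* s ℤ.* (s ℤ.* s) ℤ.* (s ℤ.* s)
        ≡⟨ (let open ℤSolver in solve 1 (λ s → s :* s :* (s :* s) :* (s :* s)
             := s :* s :* s :* (s :* s :* s)) refl s) ⟩
      N ℤ.* N ∎

  opaque
    -- If the denominator found for N = s³ is short, ξ is so close to the quotient
    -- that multiplying the pair by s keeps it a good approximation.
    next : ∀ ξ K → + 0 ℤ.≤ K → ∃[ qp ] K ℤ.< hnorm (proj₁ qp) × Good ξ qp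
    next ξ K 0≤K =
      let q , p , 0<q , q≤ , h = approximate ξ (s ℤ.* s ℤ.* s) 1<s³
      in next-from ξ s K q p 1<s K<s 0<q q≤ h
      where
      s : ℤ
      s = + 2 ℤ.+ K
      K<s : K ℤ.< s
      K<s = subst (ℤ._< s) (ℤₚ.+-identityˡ K) (ℤₚ.+-monoˡ-< K (ℤ.+<+ (ℕ.s≤s ℕ.z≤n)))
      1<s : + 1 ℤ.< s
      1<s = subst (ℤ._< s) (ℤₚ.+-identityʳ (+ 1))
        (ℤₚ.+-mono-<-≤ (ℤ.+<+ (ℕ.s≤s (ℕ.s≤s ℕ.z≤n))) 0≤K)
      1<*s : ∀ {i} → + 1 ℤ.< i → + 1 ℤ.< i ℤ.* s
      1<*s {i} 1<i = ℤₚ.<-trans 1<i (subst (ℤ._< i ℤ.* s) (ℤₚ.*-identityʳ i)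
        (ℤₚ.*-monoˡ-<-pos i {{ℤ.positive (ℤₚ.<-trans (ℤ.+<+ (ℕ.s≤s ℕ.z≤n)) 1<i)}} 1<s))
      1<s³ : + 1 ℤ.< s ℤ.* s ℤ.* s
      1<s³ = 1<*s (1<*s 1<s)

  -- Each step takes the previous |q|² as threshold, so the norms strictly increase and no pair
  -- recurs.
  good-sequence : ∀ ξ → ℕ → ∃[ qp ] Good ξ qp
  good-sequence ξ zero    = let qp , _ , good = next ξ (+ 0) ℤₚ.≤-refl in qp , good
  good-sequence ξ (suc n) =
    let (q , _) , 0<q , _ = good-sequence ξ n
        qp , _ , good     = next ξ (hnorm q) (ℤₚ.<⇒≤ 0<q)
    in qp , good

  module Sequence (ξ : ℍ) where
    qₙ pₙ : ℕ → Quat ℤ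
    qₙ n = proj₁ (proj₁ (good-sequence ξ n))
    pₙ n = proj₂ (proj₁ (good-sequence ξ n))

    hnorm-step : ∀ n → hnorm (qₙ n) ℤ.< hnorm (qₙ (suc n))
    hnorm-step n = let 0<q , _ = proj₂ (good-sequence ξ n) in
      proj₁ (proj₂ (next ξ (hnorm (qₙ n)) (ℤₚ.<⇒≤ 0<q)))

    hnorm-mono : ∀ {m n} → m ℕ.<′ n → hnorm (qₙ m) ℤ.< hnorm (qₙ n)
    hnorm-mono {m} ℕ.<′-base          = hnorm-step m
    hnorm-mono {m} (ℕ.<′-step {n} lt) = ℤₚ.<-trans (hnorm-mono lt) (hnorm-step n)

    hnorm-injective : ∀ {m n} → hnorm (qₙ m) ≡ hnorm (qₙ n) → m ≡ n
    hnorm-injective {m} {n} eq with ℕₚ.<-cmp m n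
    ... | tri< m<n _ _ = contradiction (hnorm-mono (ℕₚ.<⇒<′ m<n)) (ℤₚ.<-irrefl eq)
    ... | tri≈ _ m≡n _ = m≡n
    ... | tri> _ _ n<m = contradiction (hnorm-mono (ℕₚ.<⇒<′ n<m)) (ℤₚ.<-irrefl (sym eq))

  -- The norm depends only on the value of the Hurwitz integer; its component sequences are
  -- constant, so index 0 determines it.
  toHurwitz-hnorm : ∀ q q′ → toHurwitz q ≡ toHurwitz q′ → hnorm q ≡ hnorm q′
  toHurwitz-hnorm q q′ eq = emb-injective (begin
    emb (hnorm q)                          ≡⟨ norm-val q ⟨
    norm (val q)                           ≡⟨ cong norm (at-toHurwitz q 0) ⟨
    norm (at (toℍ (toHurwitz q)) 0)        ≡⟨ cong (λ h → norm (at (toℍ h) 0)) eq ⟩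
    norm (at (toℍ (toHurwitz q′)) 0)       ≡⟨ cong norm (at-toHurwitz q′ 0) ⟩
    norm (val q′)                          ≡⟨ norm-val q′ ⟩
    emb (hnorm q′)                         ∎)
    where open ≡-Reasoning

-- Assembly of the finite bound and the infinite family

open Reals
open Embedding
open Reduction using (hnorm)

theorem4p1 : (ξ : ℍ) →
    ((N : ℤ) (1<N : + 1 ℤ.< N) →
    Σ[ p ∈ Hurwitz ] Σ[ q ∈ Hurwitz ] Σ[ 1≤∣q∣ ∈ 1ℝ ≤ ∣ toℍ q ∣₂ ]
    ∣ toℍ q ∣₂ ≤ fromℤ N ×
    ∣ ξ -ₕ toℍ p *ₕ inv (toℍ q) (1≤⇒pos 1≤∣q∣) ∣₂
    < 2ℝ / (∣ toℍ q ∣₂ * fromℤ N) [ *-pos (1≤⇒pos 1≤∣q∣) (fromℤ-pos 1<N) ])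
    × (Σ[ f ∈ (ℕ → Hurwitz × Hurwitz) ]
    Injective _≡_ _≡_ f ×
    (∀ n → let (p , q) = f n in
    Σ[ q≠0 ∈ 0ℝ < ∣ toℍ q ∣₂ ]
    ∣ ξ -ₕ toℍ p *ₕ inv (toℍ q) q≠0 ∣₂
    < 2ℝ / (∣ toℍ q ∣₂ * ∣ toℍ q ∣₂) [ *-pos q≠0 q≠0 ]))
theorem4p1 ξ =
    (λ N 1<N →
      let q , p , 0<q , q≤N² , approx = approximate ξ N 1<N
          0<N   = ℤₚ.<-trans (ℤ.+<+ (ℕ.s≤s ℕ.z≤n)) 1<N
          1≤∣q∣ = 1≤∣toHurwitz∣₂ q 0<q
      in toHurwitz p , toHurwitz q , 1≤∣q∣ , ∣toHurwitz∣₂≤ q N 0<q (ℤₚ.<⇒≤ 0<N) q≤N² ,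
         -- Here κ = N² and `k` is the constant sequence N.
         approximates⇒< ξ q p (emb (N ℤ.* N)) (fromℤ N) 0<q (1≤emb (IntegerForms.*-pos 0<N 0<N))
           (λ n _ → emb-mono-< 0<N , ℚₚ.≤-reflexive (sym (emb-* N N)))
           approx (1≤⇒pos 1≤∣q∣) (*-pos (1≤⇒pos 1≤∣q∣) (fromℤ-pos 1<N)))
  , (λ n → toHurwitz (pₙ n) , toHurwitz (qₙ n))
  , (λ {m} {n} eq → hnorm-injective (toHurwitz-hnorm (qₙ m) (qₙ n) (cong proj₂ eq)))
  , λ n →
      let 0<q , approx = proj₂ (good-sequence ξ n)
          q≠0 = 1≤⇒pos (1≤∣toHurwitz∣₂ (qₙ n) 0<q)
      -- Here κ = |q|², and the approximate roots used for |q| have squares at most κ.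
      in q≠0 , approximates⇒< ξ (qₙ n) (pₙ n) (emb (hnorm (qₙ n))) ∣ toℍ (toHurwitz (qₙ n)) ∣₂
           0<q (1≤emb 0<q) (λ k 1≤k → ∣toHurwitz∣₂-bounds (qₙ n) 0<q k 1≤k) approx q≠0 (*-pos q≠0 q≠0)
  where open Sequence ξ
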